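{- $\mathrm{FO}(<,\sqsubset,C,Q)$ has the same expressive power as $\mathrm{FO}(\mathrm{Bit})$ on the class of all finite structures.
   Context: $\mathbb{N}=\{0,1,2,\dots\}$, $[n]=\{0,\dots,n\}$. For $i\in\mathbb{N}$ let $q_i=i(i+1)/2$. For $x\in\mathbb{N}$ let $c(x)=\max\{i: q_i\le x\}$, $q(x)=q_{c(x)}$, $r(x)=x-q(x)$ (column number, bottom element of the column, row number when $\mathbb{N}$ is arranged in a lower triangular array whose $i$-th column is $q_i,\dots,q_i+i$). Define the strict linear order $\sqsubset$ on $\mathbb{N}$ by $x\sqsubset y$ iff $r(x)<r(y)$, or $r(x)=r(y)$ and $c(x)<c(y)$. Define unary predicates $C=\{x: 2\nmid\lfloor (c(x)+1)/2^{r(x)}\rfloor\}$ and $Q=\{x: 2\nmid\lfloor q_{c(x)+1}/2^{r(x)}\rfloor\}$. $<$ is the usual order, $\mathrm{Bit}=\{(a,i): 2\nmid\lfloor a/2^i\rfloor\}$. For a numerical predicate $P\subseteq\mathbb{N}^k$, $P^n=P\cap[n]^k$. $\mathrm{FO}(\ell)$ is first-order logic over finite structures with universe $[n]$ (some $n$) in which each predicate $P$ in $\ell$ is interpreted by $P^n$. Two logics have the same expressive power if every sentence of either is equivalent on all these finite structures to a sentence of the other. -}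

module Defs where

open import Data.Nat using (ℕ; zero; suc; _+_; _*_; _≤_; _<_; _≤ᵇ_)
open import Data.Nat.Properties using (m^n≢0)
open import Data.Nat.DivMod using (_/_)
open import Data.Nat.Divisibility using (_∣_)
import Data.Nat as N
open import Data.Bool using (Bool; true; false; if_then_else_; T)
open import Data.Fin using (Fin; toℕ)
open import Data.Vec using (Vec; []; _∷_; lookup; map)
open import Data.Sum using (_⊎_; inj₁; inj₂)
open import Data.Product using (_×_; Σ; ∃)
open import Data.Empty using (⊥)
open import Relation.Nullary using (¬_)
open import Function.Bundles using (_⇔_)
open import Relation.Binary.PropositionalEquality using (_≡_)

tri : ℕ → ℕ
tri i = (i * suc i) / 2

-- largest i ≤ b with p i = true (0 if none)
maxSat : (ℕ → Bool) → ℕ → ℕ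
maxSat p zero = zero
maxSat p (suc b) = if p (suc b) then suc b else maxSat p b

-- c(x) = max { i : q_i ≤ x }  (such i always satisfy i ≤ x, as q_i ≥ i)
col : ℕ → ℕ
col x = maxSat (λ i → tri i ≤ᵇ x) x

bot : ℕ → ℕ
bot x = tri (col x)

row : ℕ → ℕ
row x = x N.∸ bot x

shr : ℕ → ℕ → ℕ
shr a i = _/_ a (2 N.^ i) {{m^n≢0 2 i}}

Bit : ℕ → ℕ → Set
Bit a i = ¬ (2 ∣ shr a i)

_⊏_ : ℕ → ℕ → Set
x ⊏ y = (row x < row y) ⊎ ((row x ≡ row y) × (col x < col y))

CPred : ℕ → Set
CPred x = ¬ (2 ∣ shr (suc (col x)) (row x))

QPred : ℕ → Set
QPred x = ¬ (2 ∣ shr (tri (suc (col x))) (row x))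

-- A vocabulary / set of predicate symbols, indexed by arity.
Voc : Set₁
Voc = ℕ → Set

data Formula (S : Voc) (m : ℕ) : Set where
  eq   : Fin m → Fin m → Formula S m
  atom : ∀ {k} → S k → Vec (Fin m) k → Formula S m
  neg  : Formula S m → Formula S m
  conj : Formula S m → Formula S m → Formula S m
  disj : Formula S m → Formula S m → Formula S m
  ex   : Formula S (suc m) → Formula S m
  all  : Formula S (suc m) → Formula S m

Sentence : Voc → Set
Sentence S = Formula S 0

_⊕_ : Voc → Voc → Voc
(σ ⊕ L) k = σ k ⊎ L k

record NumPreds : Set₁ where
  field
    Sym : Voc
    ⟦_⟧ₙ : ∀ {k} → Sym k → Vec ℕ k → Set

-- A finite σ-structure with universe [n] = {0,…,n}.
record Structure (σ : Voc) (n : ℕ) : Set where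
  field
    rel : ∀ {k} → σ k → Vec (Fin (suc n)) k → Bool

open Structure public

module _ (ℓ : NumPreds) where
  open NumPreds ℓ
  sat : ∀ {σ n m} → Structure σ n → Formula (σ ⊕ Sym) m → Vec (Fin (suc n)) m → Set
  sat A (eq i j) ρ = lookup ρ i ≡ lookup ρ j
  sat A (atom (inj₁ R) xs) ρ = T (rel A R (map (lookup ρ) xs))
  sat A (atom (inj₂ P) xs) ρ = ⟦ P ⟧ₙ (map (λ v → toℕ (lookup ρ v)) xs)
  sat A (neg φ) ρ = ¬ sat A φ ρ
  sat A (conj φ ψ) ρ = sat A φ ρ × sat A ψ ρ
  sat A (disj φ ψ) ρ = sat A φ ρ ⊎ sat A ψ ρ
  sat {n = n} A (ex φ) ρ = Σ (Fin (suc n)) (λ a → sat A φ (a ∷ ρ))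
  sat A (all φ) ρ = ∀ a → sat A φ (a ∷ ρ)

Equivalent : (ℓ₁ ℓ₂ : NumPreds) {σ : Voc} →
  Sentence (σ ⊕ NumPreds.Sym ℓ₁) → Sentence (σ ⊕ NumPreds.Sym ℓ₂) → Set
Equivalent ℓ₁ ℓ₂ {σ} φ ψ = ∀ n (A : Structure σ n) → sat ℓ₁ A φ [] ⇔ sat ℓ₂ A ψ []

_≼_ : NumPreds → NumPreds → Set₁
ℓ₁ ≼ ℓ₂ = ∀ (σ : Voc) (φ : Sentence (σ ⊕ NumPreds.Sym ℓ₁)) →
  ∃ λ (ψ : Sentence (σ ⊕ NumPreds.Sym ℓ₂)) → Equivalent ℓ₁ ℓ₂ φ ψ

SameExpressivePower : NumPreds → NumPreds → Set₁
SameExpressivePower ℓ₁ ℓ₂ = (ℓ₁ ≼ ℓ₂) × (ℓ₂ ≼ ℓ₁)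

data SymLSCQ : Voc where
  lt sq : SymLSCQ 2
  cC qQ : SymLSCQ 1

⟦_⟧LSCQ : ∀ {k} → SymLSCQ k → Vec ℕ k → Set
⟦ lt ⟧LSCQ (x ∷ y ∷ []) = x < y
⟦ sq ⟧LSCQ (x ∷ y ∷ []) = x ⊏ y
⟦ cC ⟧LSCQ (x ∷ []) = CPred x
⟦ qQ ⟧LSCQ (x ∷ []) = QPred x

LSCQ : NumPreds
LSCQ = record { Sym = SymLSCQ ; ⟦_⟧ₙ = ⟦_⟧LSCQ }

data SymBit : Voc where
  bit : SymBit 2

⟦_⟧Bit : ∀ {k} → SymBit k → Vec ℕ k → Set
⟦ bit ⟧Bit (a ∷ i ∷ []) = Bit a i

LBit : NumPreds
LBit = record { Sym = SymBit ; ⟦_⟧ₙ = ⟦_⟧Bit }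

{-# OPTIONS --safe #-}
-- In each direction the predicates of one vocabulary are defined in the other.
--
-- From Bit: a number up to n codes a set of bit positions, so sets of positions can be guessed.  Guessing
-- the initial segments of the positions occurring in positions orders these, then the positions, then all
-- numbers; addition follows by carry look-ahead.  For multiplication write the factors in base 2^w with
-- w ≈ (log log n)/3.  The partial sums of a column of the digit product and the carries between columns
-- have O(w) bits, so for factors with few enough digits all of them fit into one element, which is guessed
-- and checked locally.  A product of two digits is a divisibility statement about bit positions, verified
-- by guessing the set of multiples.  This multiplies numbers of (log n)/384 bits, and nine times splitting
-- the factors into two halves reaches all of [n]; triangular numbers, columns and rows are then definable.
--
-- To Bit: in the order ⊏ a column bottom x > 1 precedes x - 1, and this determines columns and rows.
-- C and Q store the bits of c + 1 and of q_{c+1}, so carry look-ahead along the rows yields the bits of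
-- x = q(x) + r(x), indexed by rows; a row is matched with its number by comparing their bits.

module Submission where

open import Data.Bool using (Bool; true; false; not; _xor_)
open import Data.Bool.Properties using (T-≡; not-involutive) renaming (_≟_ to _≟ᴮ_)
open import Data.Empty using (⊥; ⊥-elim)
open import Data.Fin using (Fin; zero; suc; toℕ; fromℕ<)
open import Data.Fin.Properties using (toℕ-fromℕ<; toℕ≤pred[n]; toℕ-injective; any?; all?)
open import Data.Nat
open import Data.Nat.Properties
open import Data.Nat.DivMod
open import Data.Nat.Divisibility using (_∣_; divides; divides-refl; _∣?_; ∣-refl; ∣m∣n⇒∣m+n)
open import Data.Nat.Tactic.RingSolver using (solve-∀)
open import Data.Product using (_×_; ∃; _,_; proj₁; proj₂)
open import Data.Sum using (_⊎_; inj₁; inj₂; [_,_]′)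
open import Data.Vec using (Vec; []; _∷_; lookup)
open import Data.Vec.Properties using (lookup-map; map-cong)
import Data.Vec as V
open import Data.Product.Function.NonDependent.Propositional using (_×-⇔_)
open import Data.Sum.Function.Propositional using (_⊎-⇔_)
open import Function.Bundles using (_⇔_; mk⇔; Equivalence)
open import Function.Construct.Composition using (_⇔-∘_)
open import Function.Construct.Identity using (⇔-id)
open import Function.Construct.Symmetry using (⇔-sym)
open import Function.Related.TypeIsomorphisms using (¬-cong-⇔)
open import Relation.Binary.Definitions using (tri<; tri≈; tri>)
open import Relation.Binary.PropositionalEquality using (_≡_; _≢_; refl; sym; trans; cong; cong₂; subst; subst₂; module ≡-Reasoning)
open import Relation.Nullary using (¬_; Dec; yes; no; does; contradiction)
open import Relation.Nullary.Decidable using (_×-dec_; _⊎-dec_; ¬?)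
open import Defs renaming (eq to eqᶠ; atom to atomᶠ; neg to negᶠ; conj to conjᶠ; disj to disjᶠ; ex to exᶠ; all to allᶠ)

-- An element of [n] carries only about log n bits, and no single guess is longer. Hence initial
-- segments are not guessed for the positions themselves: these segments are numbers of the size of
-- n, and a set of them would need about n bits. One logarithm further down, a set of initial
-- segments has at most log n bits. The same limit yields the digit width: the multiples checked for
-- a product of two w-bit digits reach 2^(3w), so their set needs about 2^(3w) bits, which must not
-- exceed log n. Nor could all partial sums of a digit product be held in one element; each column
-- therefore has a guess of its own, made inside the step that uses its sum. The other recurring
-- difficulty is that c + 1, q_{c+1} or the sum of two elements may lie beyond n. Such a number is
-- then accessible only through its bits, and the few small cases in which even an auxiliary element
-- is missing are listed in the formulas.

private
  variable
    m n : ℕ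

open Equivalence using (to; from)

-- Definability

⇔-refl : {A : Set} → A ⇔ A
⇔-refl = ⇔-id _

⇔-trans : {A B C : Set} → A ⇔ B → B ⇔ C → A ⇔ C
⇔-trans f g = g ⇔-∘ f

≡⇒⇔ : {A B : Set} → A ≡ B → A ⇔ B
≡⇒⇔ refl = ⇔-refl

_!_ : Vec ℕ m → Fin m → ℕ
_!_ = lookup

values : Vec (Fin (suc n)) m → Vec ℕ m
values = V.map toℕ

values-! : (ρ : Vec (Fin (suc n)) m) (i : Fin m) → values ρ ! i ≡ toℕ (lookup ρ i)
values-! ρ i = lookup-map i toℕ ρ

values-≤ : (ρ : Vec (Fin (suc n)) m) (i : Fin m) → values ρ ! i ≤ n
values-≤ ρ i = ≤-trans (≤-reflexive (values-! ρ i)) (toℕ≤pred[n] (lookup ρ i))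

infix 2 ∃≤ ∀≤
∃≤ ∀≤ : ℕ → (ℕ → Set) → Set
∃≤ n P = ∃ λ a → (a ≤ n) × P a
∀≤ n P = ∀ a → a ≤ n → P a
syntax ∃≤ n (λ a → P) = ∃[ a ≤ n ] P
syntax ∀≤ n (λ a → P) = ∀[ a ≤ n ] P

∃-Fin⇔ : ∀ {n} {P : ℕ → Set} → (∃ λ (a : Fin (suc n)) → P (toℕ a)) ⇔ ∃≤ n P
∃-Fin⇔ {P = P} = mk⇔ (λ (a , p) → toℕ a , toℕ≤pred[n] a , p)
           (λ (a , a≤n , p) → fromℕ< (s≤s a≤n) , subst P (sym (toℕ-fromℕ< _)) p)

∀-Fin⇔ : ∀ {n} {P : ℕ → Set} → ((a : Fin (suc n)) → P (toℕ a)) ⇔ ∀≤ n P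
∀-Fin⇔ {P = P} = mk⇔ (λ f a a≤n → subst P (toℕ-fromℕ< _) (f (fromℕ< (s≤s a≤n))))
                    (λ f a → f (toℕ a) (toℕ≤pred[n] a))

module FO (ℓ : NumPreds)
          (dec : ∀ {k} (P : NumPreds.Sym ℓ k) xs → Dec (NumPreds.⟦_⟧ₙ ℓ P xs)) where
  open NumPreds ℓ

  sat? : ∀ {σ n m} (A : Structure σ n) (φ : Formula (σ ⊕ Sym) m) ρ → Dec (sat ℓ A φ ρ)
  sat? A (eqᶠ i j) ρ = lookup ρ i Data.Fin.≟ lookup ρ j
  sat? A (atomᶠ (inj₁ R) xs) ρ = Data.Bool.T? _
  sat? A (atomᶠ (inj₂ P) xs) ρ = dec P _
  sat? A (negᶠ φ) ρ = ¬? (sat? A φ ρ)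
  sat? A (conjᶠ φ ψ) ρ = sat? A φ ρ ×-dec sat? A ψ ρ
  sat? A (disjᶠ φ ψ) ρ = sat? A φ ρ ⊎-dec sat? A ψ ρ
  sat? A (exᶠ φ) ρ = any? (λ a → sat? A φ (a ∷ ρ))
  sat? A (allᶠ φ) ρ = all? (λ a → sat? A φ (a ∷ ρ))

  -- `R` speaks of numbers and takes the maximum `n` of the universe as an argument, so bounded
  -- quantification leads from definable relations to definable relations. One formula serves all
  -- `n` and all `σ`.
  record Def {m} (R : ℕ → Vec ℕ m → Set) : Set₁ where
    field
      formula : ∀ {σ} → Formula (σ ⊕ Sym) m
      correct : ∀ {σ n} (A : Structure σ n) ρ → sat ℓ A formula ρ ⇔ R n (values ρ)
  open Def public

  private
    variable
      R S : ℕ → Vec ℕ m → Set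

  -- The equivalence may assume that all arguments lie in [n]; this is how intermediate values of a
  -- definition are shown to be elements.
  reformulate : Def R → (∀ {n ρ} → (∀ i → ρ ! i ≤ n) → R n ρ ⇔ S n ρ) → Def S
  reformulate D f .formula = D .formula
  reformulate D f .correct A ρ = ⇔-trans (D .correct A ρ) (f (values-≤ ρ))

  eqᵈ : ∀ {m} (i j : Fin m) → Def (λ n ρ → ρ ! i ≡ ρ ! j)
  eqᵈ i j .formula = eqᶠ i j
  eqᵈ i j .correct A ρ =
    mk⇔ (λ e → trans (values-! ρ i) (trans (cong toℕ e) (sym (values-! ρ j))))
        (λ e → toℕ-injective (trans (sym (values-! ρ i)) (trans e (values-! ρ j))))

  atomᵈ : ∀ {m k} (P : Sym k) (xs : Vec (Fin m) k) → Def (λ n ρ → ⟦ P ⟧ₙ (V.map (ρ !_) xs))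
  atomᵈ P xs .formula = atomᶠ (inj₂ P) xs
  atomᵈ P xs .correct A ρ = ≡⇒⇔ (cong ⟦ P ⟧ₙ (sym (map-cong (values-! ρ) xs)))

  infixr 3 _∧ᵈ_
  infixr 2 _∨ᵈ_
  infixr 1 _⇒ᵈ_
  infix 4 ¬ᵈ_
  infix 0 ∃ᵈ_ ∀ᵈ_

  ¬ᵈ_ : Def R → Def (λ n ρ → ¬ R n ρ)
  (¬ᵈ D) .formula = negᶠ (D .formula)
  (¬ᵈ D) .correct A ρ = ¬-cong-⇔ (D .correct A ρ)

  _∧ᵈ_ : Def R → Def S → Def (λ n ρ → R n ρ × S n ρ)
  (D ∧ᵈ E) .formula = conjᶠ (D .formula) (E .formula)
  (D ∧ᵈ E) .correct A ρ = D .correct A ρ ×-⇔ E .correct A ρ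

  _∨ᵈ_ : Def R → Def S → Def (λ n ρ → R n ρ ⊎ S n ρ)
  (D ∨ᵈ E) .formula = disjᶠ (D .formula) (E .formula)
  (D ∨ᵈ E) .correct A ρ = D .correct A ρ ⊎-⇔ E .correct A ρ

  -- `Formula` has no implication. The disjunction used instead is constructively equivalent to it
  -- because satisfaction in a finite structure is decidable.
  _⇒ᵈ_ : Def R → Def S → Def (λ n ρ → R n ρ → S n ρ)
  (D ⇒ᵈ E) .formula = disjᶠ (negᶠ (D .formula)) (E .formula)
  (D ⇒ᵈ E) .correct A ρ = mk⇔
    [ (λ ¬d r → ⊥-elim (¬d (from (D .correct A ρ) r))) , (λ e _ → to (E .correct A ρ) e) ]′
    (λ f → case (sat? A (D .formula) ρ) f)
    where
    case : Dec _ → _ → _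
    case (yes d) f = inj₂ (from (E .correct A ρ) (f (to (D .correct A ρ) d)))
    case (no ¬d) f = inj₁ ¬d

  ∃ᵈ_ : {R : ℕ → Vec ℕ (suc m) → Set} → Def R → Def (λ n ρ → ∃[ a ≤ n ] R n (a ∷ ρ))
  (∃ᵈ D) .formula = exᶠ (D .formula)
  (∃ᵈ_ {R = R} D) .correct {n = n} A ρ = ⇔-trans
    (mk⇔ (λ (a , s) → a , to (D .correct A (a ∷ ρ)) s) (λ (a , s) → a , from (D .correct A (a ∷ ρ)) s))
    (∃-Fin⇔ {P = λ a → R n (a ∷ values ρ)})

  ∀ᵈ_ : {R : ℕ → Vec ℕ (suc m) → Set} → Def R → Def (λ n ρ → ∀[ a ≤ n ] R n (a ∷ ρ))
  (∀ᵈ D) .formula = allᶠ (D .formula)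
  (∀ᵈ_ {R = R} D) .correct {n = n} A ρ = ⇔-trans
    (mk⇔ (λ f a → to (D .correct A (a ∷ ρ)) (f a)) (λ f a → from (D .correct A (a ∷ ρ)) (f a)))
    (∀-Fin⇔ {P = λ a → R n (a ∷ values ρ)})

  infixr 1 _⇔ᵈ_
  _⇔ᵈ_ : Def R → Def S → Def (λ n ρ → R n ρ ⇔ S n ρ)
  D ⇔ᵈ E = reformulate ((D ⇒ᵈ E) ∧ᵈ (E ⇒ᵈ D))
    (λ _ → mk⇔ (λ (f , g) → mk⇔ f g) (λ e → to e , from e))

  DefB : (ℕ → Vec ℕ m → Bool) → Set₁
  DefB f = Def (λ n ρ → f n ρ ≡ true)

  ≡true : ∀ {a b} → (a ≡ true ⇔ b ≡ true) ⇔ (a ≡ b)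
  ≡true {false} {false} = mk⇔ (λ _ → refl) (λ _ → ⇔-refl)
  ≡true {false} {true} = mk⇔ (λ e → from e refl) (λ ())
  ≡true {true} {false} = mk⇔ (λ e → sym (to e refl)) (λ ())
  ≡true {true} {true} = mk⇔ (λ _ → refl) (λ _ → ⇔-refl)

  ≡ᵇ : {f g : ℕ → Vec ℕ m → Bool} → DefB f → DefB g → Def (λ n ρ → f n ρ ≡ g n ρ)
  ≡ᵇ D E = reformulate (D ⇔ᵈ E) (λ _ → ≡true)

  xorᵇ : {f g : ℕ → Vec ℕ m → Bool} → DefB f → DefB g → DefB (λ n ρ → f n ρ xor g n ρ)
  xorᵇ {f = f} {g} D E = reformulate (¬ᵈ ≡ᵇ D E) (λ {n ρ} _ → ≢⇔xor (f n ρ) (g n ρ))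
    where
    ≢⇔xor : ∀ a b → (¬ (a ≡ b)) ⇔ (a xor b ≡ true)
    ≢⇔xor false false = mk⇔ (λ ne → ⊥-elim (ne refl)) (λ ())
    ≢⇔xor false true = mk⇔ (λ _ → refl) (λ _ ())
    ≢⇔xor true false = mk⇔ (λ _ → refl) (λ _ ())
    ≢⇔xor true true = mk⇔ (λ ne → ⊥-elim (ne refl)) (λ ())

-- Translating sentences along definitions of the predicates

module Translation (ℓ₁ ℓ₂ : NumPreds)
                   (dec₂ : ∀ {k} (P : NumPreds.Sym ℓ₂ k) xs → Dec (NumPreds.⟦_⟧ₙ ℓ₂ P xs))
                   (define : ∀ {m k} (P : NumPreds.Sym ℓ₁ k) (xs : Vec (Fin m) k) →
                             FO.Def ℓ₂ dec₂ (λ n ρ → NumPreds.⟦_⟧ₙ ℓ₁ P (V.map (ρ !_) xs))) where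
  open NumPreds
  open FO ℓ₂ dec₂

  translate : ∀ {σ} → Formula (σ ⊕ Sym ℓ₁) m → Formula (σ ⊕ Sym ℓ₂) m
  translate (eqᶠ i j) = eqᶠ i j
  translate (atomᶠ (inj₁ R) xs) = atomᶠ (inj₁ R) xs
  translate (atomᶠ (inj₂ P) xs) = define P xs .formula
  translate (negᶠ φ) = negᶠ (translate φ)
  translate (conjᶠ φ ψ) = conjᶠ (translate φ) (translate ψ)
  translate (disjᶠ φ ψ) = disjᶠ (translate φ) (translate ψ)
  translate (exᶠ φ) = exᶠ (translate φ)
  translate (allᶠ φ) = allᶠ (translate φ)

  translate-correct : ∀ {σ} (A : Structure σ n) (φ : Formula (σ ⊕ Sym ℓ₁) m) ρ →
                      sat ℓ₁ A φ ρ ⇔ sat ℓ₂ A (translate φ) ρ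
  translate-correct A (eqᶠ i j) ρ = ⇔-refl
  translate-correct A (atomᶠ (inj₁ R) xs) ρ = ⇔-refl
  translate-correct A (atomᶠ (inj₂ P) xs) ρ = ⇔-trans
    (≡⇒⇔ (cong (⟦_⟧ₙ ℓ₁ P) (sym (map-cong (values-! ρ) xs))))
    (⇔-sym (define P xs .correct A ρ))
  translate-correct A (negᶠ φ) ρ = ¬-cong-⇔ (translate-correct A φ ρ)
  translate-correct A (conjᶠ φ ψ) ρ = translate-correct A φ ρ ×-⇔ translate-correct A ψ ρ
  translate-correct A (disjᶠ φ ψ) ρ = translate-correct A φ ρ ⊎-⇔ translate-correct A ψ ρ
  translate-correct A (exᶠ φ) ρ = mk⇔
    (λ (a , s) → a , to (translate-correct A φ (a ∷ ρ)) s)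
    (λ (a , s) → a , from (translate-correct A φ (a ∷ ρ)) s)
  translate-correct A (allᶠ φ) ρ = mk⇔
    (λ f a → to (translate-correct A φ (a ∷ ρ)) (f a))
    (λ f a → from (translate-correct A φ (a ∷ ρ)) (f a))

  ≼-translate : ℓ₁ ≼ ℓ₂
  ≼-translate σ φ = translate φ , λ n A → translate-correct A φ []

-- Binary digits

odd : ℕ → Bool
odd zero = false
odd (suc n) = not (odd n)

⟨_⟩ : Bool → ℕ
⟨ false ⟩ = 0
⟨ true ⟩ = 1

opaque
  infix 8 _at_
  -- Boolean-valued, so that bits can be compared and added modulo 2, and recursive on the position,
  -- so that inductions strip the lowest bit.
  _at_ : ℕ → ℕ → Bool
  a at zero = odd a
  a at suc i = ⌊ a /2⌋ at i

opaque
  low : ℕ → ℕ → ℕ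
  low a k = _%_ a (2 ^ k) {{m^n≢0 2 k}}

opaque
  fromBits : (ℕ → Bool) → ℕ → ℕ
  fromBits f zero = 0
  fromBits f (suc k) = ⟨ f 0 ⟩ + 2 * fromBits (λ i → f (suc i)) k

⟨⟩≤1 : ∀ b → ⟨ b ⟩ ≤ 1
⟨⟩≤1 false = z≤n
⟨⟩≤1 true = ≤-refl

halves : ∀ a → a ≡ ⟨ odd a ⟩ + 2 * ⌊ a /2⌋
halves zero = refl
halves (suc zero) = refl
halves (suc (suc a)) = trans (cong (λ x → suc (suc x)) (halves a))
  (trans (shift ⟨ odd a ⟩ ⌊ a /2⌋) (cong (λ b → ⟨ b ⟩ + 2 * suc ⌊ a /2⌋) (sym (not-involutive (odd a)))))
  where
  shift : ∀ b h → 2 + (b + 2 * h) ≡ b + 2 * (1 + h)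
  shift = solve-∀

odd-double : ∀ b h → odd (⟨ b ⟩ + 2 * h) ≡ b
odd-double false zero = refl
odd-double true zero = refl
odd-double b (suc h) = trans (cong odd (shift ⟨ b ⟩ h)) (trans (not-involutive _) (odd-double b h))
  where
  shift : ∀ b h → b + 2 * (1 + h) ≡ 2 + (b + 2 * h)
  shift = solve-∀

half-double : ∀ b h → ⌊ ⟨ b ⟩ + 2 * h /2⌋ ≡ h
half-double false zero = refl
half-double true zero = refl
half-double b (suc h) = trans (cong ⌊_/2⌋ (shift ⟨ b ⟩ h)) (cong suc (half-double b h))
  where
  shift : ∀ b h → b + 2 * (1 + h) ≡ 2 + (b + 2 * h)
  shift = solve-∀

maj : Bool → Bool → Bool → Bool
maj true true c = true
maj true false c = c
maj false true c = c
maj false false c = false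

digit< : ∀ b k {l} → l < 2 ^ k → ⟨ b ⟩ + 2 * l < 2 ^ suc k
digit< b k {l} l< = begin-strict
  ⟨ b ⟩ + 2 * l ≤⟨ +-monoˡ-≤ _ (⟨⟩≤1 b) ⟩
  1 + 2 * l     <⟨ ≤-reflexive (sym (*-suc 2 l)) ⟩
  2 * suc l     ≤⟨ *-monoʳ-≤ 2 l< ⟩
  2 ^ suc k     ∎
  where open ≤-Reasoning

regroup : ∀ b l s p → b + 2 * (l + s * p) ≡ (b + 2 * l) + s * (2 * p)
regroup = solve-∀

-- A full adder in the lowest place: the parity stays, the majority is carried into the sum of the
-- halves.
add-halves : ∀ c x y → ⟨ c ⟩ + x + y ≡
  ⟨ (odd x xor odd y) xor c ⟩ + 2 * (⟨ maj (odd x) (odd y) c ⟩ + ⌊ x /2⌋ + ⌊ y /2⌋)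
add-halves c x y = trans (cong₂ (λ x y → ⟨ c ⟩ + x + y) (halves x) (halves y)) (lemma c (odd x) (odd y) ⌊ x /2⌋ ⌊ y /2⌋)
  where
  lemma : ∀ c a b h k → ⟨ c ⟩ + (⟨ a ⟩ + 2 * h) + (⟨ b ⟩ + 2 * k) ≡
          ⟨ (a xor b) xor c ⟩ + 2 * (⟨ maj a b c ⟩ + h + k)
  lemma false false false = solve-∀
  lemma false false true = solve-∀
  lemma false true false = solve-∀
  lemma false true true = solve-∀
  lemma true false false = solve-∀
  lemma true false true = solve-∀
  lemma true true false = solve-∀
  lemma true true true = solve-∀

opaque
  unfolding _at_ low fromBits

  low+shr : ∀ a k → a ≡ low a k + shr a k * 2 ^ k
  low+shr a k = m≡m%n+[m/n]*n a (2 ^ k) {{m^n≢0 2 k}}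

opaque
  unfolding _at_ low fromBits

  low< : ∀ a k → low a k < 2 ^ k
  low< a k = m%n<n a (2 ^ k) {{m^n≢0 2 k}}

opaque
  unfolding _at_ low fromBits

  low≤ : ∀ a k → low a k ≤ a
  low≤ a k = m%n≤m a (2 ^ k) {{m^n≢0 2 k}}

shr≤ : ∀ a k → shr a k ≤ a
shr≤ a k = m/n≤m a (2 ^ k) {{m^n≢0 2 k}}

shr-unique : ∀ k {r} q → r < 2 ^ k → shr (r + q * 2 ^ k) k ≡ q
shr-unique k {r} q r< = let instance _ = m^n≢0 2 k in
  trans (+-distrib-/-∣ʳ r (divides-refl q)) (cong₂ _+_ (m<n⇒m/n≡0 r<) (m*n/n≡m q (2 ^ k)))

opaque
  unfolding _at_ low fromBits

  low-unique : ∀ k {r} q → r < 2 ^ k → low (r + q * 2 ^ k) k ≡ r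
  low-unique k {r} q r< = let instance _ = m^n≢0 2 k in
    trans ([m+kn]%n≡m%n r q (2 ^ k)) (m<n⇒m%n≡m r<)

shr-suc : ∀ a k → shr a (suc k) ≡ shr ⌊ a /2⌋ k
shr-suc a k = trans (cong (λ x → shr x (suc k)) decomposed) (shr-unique (suc k) (shr h k) small)
  where
  h = ⌊ a /2⌋
  b = ⟨ odd a ⟩
  decomposed : a ≡ (b + 2 * low h k) + shr h k * 2 ^ suc k
  decomposed = trans (halves a) (trans (cong (λ x → b + 2 * x) (low+shr h k)) (regroup b (low h k) (shr h k) (2 ^ k)))
  small : b + 2 * low h k < 2 ^ suc k
  small = digit< (odd a) k (low< h k)

shr-zero : ∀ a → shr a 0 ≡ a
shr-zero a = n/1≡n a

opaque
  unfolding _at_ low fromBits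

  at-shr : ∀ a k i → shr a k at i ≡ a at (k + i)
  at-shr a zero i = cong (_at i) (shr-zero a)
  at-shr a (suc k) i = trans (cong (_at i) (shr-suc a k)) (at-shr ⌊ a /2⌋ k i)

odd-∣ : ∀ a → (¬ (2 ∣ a)) ⇔ (odd a ≡ true)
odd-∣ a = mk⇔ ltr rtl
  where
  ltr : ¬ (2 ∣ a) → odd a ≡ true
  ltr ¬d with odd a | halves a
  ... | true | _ = refl
  ... | false | e = contradiction (divides ⌊ a /2⌋ (trans e (*-comm 2 ⌊ a /2⌋))) ¬d
  rtl : odd a ≡ true → ¬ (2 ∣ a)
  rtl e (divides q refl) with trans (sym e) (trans (cong odd (*-comm q 2)) (odd-double false q))
  ... | ()

opaque
  unfolding _at_ low fromBits

  Bit⇔at : ∀ a i → Bit a i ⇔ (a at i ≡ true)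
  Bit⇔at a i = ⇔-trans (odd-∣ (shr a i))
    (≡⇒⇔ (cong (_≡ true) (trans (at-shr a i 0) (cong (a at_) (+-identityʳ i)))))

opaque
  unfolding _at_ low fromBits

  zero-at : ∀ i → 0 at i ≡ false
  zero-at zero = refl
  zero-at (suc i) = zero-at i

opaque
  unfolding _at_ low fromBits

  at-true⇒≤ : ∀ {a} i → a at i ≡ true → 2 ^ i ≤ a
  at-true⇒≤ {zero} zero ()
  at-true⇒≤ {suc a} zero e = s≤s z≤n
  at-true⇒≤ {a} (suc i) e = ≤-trans (*-monoʳ-≤ 2 (at-true⇒≤ i e))
    (subst (2 * ⌊ a /2⌋ ≤_) (sym (halves a)) (m≤n+m _ ⟨ odd a ⟩))

at-< : ∀ {a} i → a < 2 ^ i → a at i ≡ false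
at-< {a} i a< with a at i in e
... | false = refl
... | true = contradiction (at-true⇒≤ i e) (<⇒≱ a<)

n<2^n : ∀ n → n < 2 ^ n
n<2^n zero = s≤s z≤n
n<2^n (suc n) = begin-strict
  suc n <⟨ s≤s (n<2^n n) ⟩
  1 + 2 ^ n ≤⟨ +-monoˡ-≤ (2 ^ n) (m^n>0 2 n) ⟩
  2 ^ n + 2 ^ n ≡⟨ cong (2 ^ n +_) (sym (+-identityʳ _)) ⟩
  2 ^ suc n ∎
  where open ≤-Reasoning

at-true⇒< : ∀ {a} i → a at i ≡ true → i < a
at-true⇒< i e = <-≤-trans (n<2^n i) (at-true⇒≤ i e)

half-< : ∀ {a} k → a < 2 ^ suc k → ⌊ a /2⌋ < 2 ^ k
half-< {a} k a< = *-cancelˡ-< 2 _ _ (≤-<-trans (subst (2 * ⌊ a /2⌋ ≤_) (sym (halves a)) (m≤n+m _ ⟨ odd a ⟩)) a<)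

opaque
  unfolding _at_ low fromBits

  at-ext< : ∀ k {a b} → a < 2 ^ k → b < 2 ^ k → (∀ i → i < k → a at i ≡ b at i) → a ≡ b
  at-ext< zero (s≤s z≤n) (s≤s z≤n) f = refl
  at-ext< (suc k) {a} {b} a< b< f = trans (halves a) (trans
    (cong₂ (λ o h → ⟨ o ⟩ + 2 * h) (f 0 (s≤s z≤n)) (at-ext< k (half-< k a<) (half-< k b<) λ i i< → f (suc i) (s≤s i<)))
    (sym (halves b)))

at-ext : ∀ {a b} → (∀ i → a at i ≡ b at i) → a ≡ b
at-ext {a} {b} f = at-ext< (a + b) (<-≤-trans (n<2^n a) (^-monoʳ-≤ 2 (m≤m+n a b)))
                                   (<-≤-trans (n<2^n b) (^-monoʳ-≤ 2 (m≤n+m b a))) (λ i _ → f i)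

opaque
  unfolding _at_ low fromBits

  fromBits-at : ∀ f {k i} → i < k → fromBits f k at i ≡ f i
  fromBits-at f {suc k} {zero} (s≤s _) = odd-double (f 0) (fromBits (λ i → f (suc i)) k)
  fromBits-at f {suc k} {suc i} (s≤s i<) = trans (cong (_at i) (half-double (f 0) (fromBits (λ i → f (suc i)) k))) (fromBits-at (λ i → f (suc i)) i<)

opaque
  unfolding _at_ low fromBits

  fromBits< : ∀ f k → fromBits f k < 2 ^ k
  fromBits< f zero = s≤s z≤n
  fromBits< f (suc k) = digit< (f 0) k (fromBits< (λ i → f (suc i)) k)

fromBits-at-≥ : ∀ f {k i} → k ≤ i → fromBits f k at i ≡ false
fromBits-at-≥ f {k} {i} k≤i = at-< i (<-≤-trans (fromBits< f k) (^-monoʳ-≤ 2 k≤i))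

fromBits-true : ∀ f {k i} → fromBits f k at i ≡ true → i < k × f i ≡ true
fromBits-true f {k} {i} e with i <? k
... | yes i<k = i<k , trans (sym (fromBits-at f i<k)) e
... | no i≮k with trans (sym e) (fromBits-at-≥ f (≮⇒≥ i≮k))
...   | ()

opaque
  unfolding _at_ low fromBits

  at-low : ∀ a k i → i < k → low a k at i ≡ a at i
  at-low a k i i<k = trans (cong (_at i) (sym eq)) (fromBits-at (a at_) i<k)
    where
    go : ∀ k a → fromBits (a at_) k + shr a k * 2 ^ k ≡ a
    go zero a = trans (*-identityʳ _) (shr-zero a)
    go (suc k) a = trans (cong (λ x → fromBits (a at_) (suc k) + x * 2 ^ suc k) (shr-suc a k))
      (trans (sym (regroup ⟨ odd a ⟩ (fromBits (λ i → a at suc i) k) (shr ⌊ a /2⌋ k) (2 ^ k))) (trans (cong (λ x → ⟨ odd a ⟩ + 2 * x) (go k ⌊ a /2⌋)) (sym (halves a))))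
    eq : fromBits (a at_) k ≡ low a k
    eq = trans (sym (low-unique k (shr a k) (fromBits< (a at_) k))) (cong (λ x → low x k) (go k a))

at-low-≥ : ∀ a k i → k ≤ i → low a k at i ≡ false
at-low-≥ a k i k≤i = at-< i (<-≤-trans (low< a k) (^-monoʳ-≤ 2 k≤i))

-- The incoming carry is a parameter because halving both summands turns the carry out of the lowest
-- place into an incoming one.
carryFrom : Bool → ℕ → ℕ → ℕ → Bool
carryFrom c x y zero = c
carryFrom c x y (suc k) = carryFrom (maj (odd x) (odd y) c) ⌊ x /2⌋ ⌊ y /2⌋ k

opaque
  unfolding _at_ low fromBits

  carryFrom-suc : ∀ c x y k → carryFrom c x y (suc k) ≡ maj (x at k) (y at k) (carryFrom c x y k)
  carryFrom-suc c x y zero = refl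
  carryFrom-suc c x y (suc k) = carryFrom-suc _ ⌊ x /2⌋ ⌊ y /2⌋ k

opaque
  unfolding _at_ low fromBits

  at-carryFrom : ∀ c x y k → (⟨ c ⟩ + x + y) at k ≡ (x at k xor y at k) xor carryFrom c x y k
  at-carryFrom c x y zero = trans (cong odd (add-halves c x y)) (odd-double _ (⟨ maj (odd x) (odd y) c ⟩ + ⌊ x /2⌋ + ⌊ y /2⌋))
  at-carryFrom c x y (suc k) = trans
    (cong (_at k) (trans (cong ⌊_/2⌋ (add-halves c x y)) (half-double ((odd x xor odd y) xor c) _)))
    (at-carryFrom (maj (odd x) (odd y) c) ⌊ x /2⌋ ⌊ y /2⌋ k)

carry : ℕ → ℕ → ℕ → Bool
carry = carryFrom false

at-+ : ∀ x y k → (x + y) at k ≡ (x at k xor y at k) xor carry x y k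
at-+ = at-carryFrom false

-- Carry look-ahead: a carry into position k is generated at some j < k and propagated from there.
Generated : ℕ → ℕ → ℕ → ℕ → Set
Generated x y k j = j < k × (x at j ≡ true × y at j ≡ true) ×
  (∀ l → j < l → l < k → x at l ≡ true ⊎ y at l ≡ true)

carry⇔generated : ∀ x y k → (carry x y k ≡ true) ⇔ (∃ λ j → Generated x y k j)
carry⇔generated x y zero = mk⇔ (λ ()) (λ { (j , () , _) })
carry⇔generated x y (suc k) = mk⇔
  (λ e → ltr (trans (sym (carryFrom-suc false x y k)) e))
  (λ { (j , j< , g , p) → trans (carryFrom-suc false x y k) (rtl j j< g p) })
  where
  IH = carry⇔generated x y k
  keep : x at k ≡ true ⊎ y at k ≡ true → (∃ λ j → Generated x y k j) → ∃ λ j → Generated x y (suc k) j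
  keep here (j , j<k , g , p) = j , m<n⇒m<1+n j<k , g , λ l j<l l<sk →
    [ p l j<l , (λ { refl → here }) ]′ (m≤n⇒m<n∨m≡n (≤-pred l<sk))
  ltr : maj (x at k) (y at k) (carry x y k) ≡ true → ∃ λ j → Generated x y (suc k) j
  ltr e with x at k in ex | y at k in ey
  ... | true | true = k , ≤-refl , (ex , ey) , λ l k<l l<sk → contradiction l<sk (≤⇒≯ k<l)
  ... | true | false = keep (inj₁ ex) (to IH e)
  ... | false | true = keep (inj₂ ey) (to IH e)
  ltr () | false | false
  maj-both : ∀ {a b} c → a ≡ true → b ≡ true → maj a b c ≡ true
  maj-both c refl refl = refl
  maj-either : ∀ {a b c} → a ≡ true ⊎ b ≡ true → c ≡ true → maj a b c ≡ true
  maj-either {true} {true} _ _ = refl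
  maj-either {true} {false} _ e = e
  maj-either {false} {true} _ e = e
  maj-either {false} {false} (inj₁ ()) _
  maj-either {false} {false} (inj₂ ()) _
  rtl : ∀ j → j < suc k → x at j ≡ true × y at j ≡ true →
        (∀ l → j < l → l < suc k → x at l ≡ true ⊎ y at l ≡ true) →
        maj (x at k) (y at k) (carry x y k) ≡ true
  rtl j j< (gx , gy) p with m≤n⇒m<n∨m≡n (≤-pred j<)
  ... | inj₂ refl = maj-both _ gx gy
  ... | inj₁ j<k = maj-either (p k j<k ≤-refl)
                     (from IH (j , j<k , (gx , gy) , λ l j<l l<k → p l j<l (m<n⇒m<1+n l<k)))

-- Comparison by the highest differing bit

BitLess : ℕ → ℕ → Set
BitLess x y = ∃ λ k → y at k ≡ true × x at k ≡ false × (∀ l → k < l → x at l ≡ y at l)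

opaque
  unfolding _at_ low fromBits

  <⇒BitLess : ∀ {x y} → x < y → BitLess x y
  <⇒BitLess {x} {y} x<y = go y (n<2^n y) x<y
    where
    go : ∀ k {x y} → y < 2 ^ k → x < y → BitLess x y
    go zero (s≤s z≤n) ()
    go (suc k) {x} {y} y< x<y with <-cmp ⌊ x /2⌋ ⌊ y /2⌋
    ... | tri< h< _ _ = let (i , ey , ex , f) = go k (half-< k y<) h< in
          suc i , ey , ex , λ { (suc l) (s≤s i<l) → f l i<l }
    ... | tri≈ _ h≡ _ = let (ey , ex) = units (odd x) (odd y) (subst₂ _<_ (halves x) (trans (halves y) (cong (λ h → ⟨ odd y ⟩ + 2 * h) (sym h≡))) x<y) in
          0 , ey , ex , λ { (suc l) _ → cong (_at l) h≡ }
      where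
      units : ∀ a b {h} → ⟨ a ⟩ + h < ⟨ b ⟩ + h → b ≡ true × a ≡ false
      units false false p = contradiction p (<-irrefl refl)
      units false true p = refl , refl
      units true false p = contradiction p (≤⇒≯ (n≤1+n _))
      units true true p = contradiction p (<-irrefl refl)
    ... | tri> _ _ h> = contradiction (⌊n/2⌋-mono (<⇒≤ x<y)) (<⇒≱ h>)

opaque
  unfolding _at_ low fromBits

  BitLess⇒< : ∀ {x y} → BitLess x y → x < y
  BitLess⇒< (k , ey , ex , f) = go k ey ex f
    where
    go : ∀ k {x y} → y at k ≡ true → x at k ≡ false → (∀ l → k < l → x at l ≡ y at l) → x < y
    go zero {x} {y} ey ex f = subst₂ _<_
      (sym (trans (halves x) (cong₂ (λ b h → ⟨ b ⟩ + 2 * h) ex (at-ext λ i → f (suc i) (s≤s z≤n)))))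
      (sym (trans (halves y) (cong (λ b → ⟨ b ⟩ + 2 * ⌊ y /2⌋) ey))) ≤-refl
    go (suc k) {x} {y} ey ex f = ≰⇒> λ y≤x → <⇒≱ (go k ey ex λ l k<l → f (suc l) (s≤s k<l)) (⌊n/2⌋-mono y≤x)

-- The order is definable from Bit

does⇔ : {P : Set} (d : Dec P) → (does d ≡ true) ⇔ P
does⇔ (yes p) = mk⇔ (λ _ → p) (λ _ → refl)
does⇔ (no ¬p) = mk⇔ (λ ()) (λ p → contradiction p ¬p)

module Comprehension {P : ℕ → Set} (P? : ∀ i → Dec (P i)) (k : ℕ) where
  set : ℕ
  set = fromBits (λ i → does (P? i)) k

  set< : set < 2 ^ k
  set< = fromBits< _ k

  ∈set : ∀ {i} → (set at i ≡ true) ⇔ (i < k × P i)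
  ∈set {i} = mk⇔ (λ e → let (i< , d) = fromBits-true _ e in i< , to (does⇔ (P? i)) d)
                 (λ (i< , p) → trans (fromBits-at _ i<) (from (does⇔ (P? i)) p))

topBit : ∀ y → 0 < y → ∃ λ i → 2 ^ i ≤ y × y < 2 ^ suc i
topBit (suc zero) _ = 0 , ≤-refl , ≤-refl
topBit (suc y@(suc _)) _ with topBit y (s≤s z≤n)
... | i , lo , hi with m≤n⇒m<n∨m≡n hi
...   | inj₁ sy< = i , m≤n⇒m≤1+n lo , sy<
...   | inj₂ sy≡ = suc i , ≤-reflexive (sym sy≡) , ≤-trans (s≤s (≤-reflexive sy≡)) (^-monoʳ-< 2 ≤-refl (≤-refl {2 + i}))

true≢false : ∀ {b} → b ≡ true → b ≢ false
true≢false refl ()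

≢true⇒false : ∀ {b} → ¬ (b ≡ true) → b ≡ false
≢true⇒false {false} _ = refl
≢true⇒false {true} ne = contradiction refl ne

2^-cancel-< : ∀ {i j} → 2 ^ i < 2 ^ j → i < j
2^-cancel-< p = ≰⇒> λ j≤i → <⇒≱ p (^-monoʳ-≤ 2 j≤i)

-- This is `BitLess` with `R` in place of the order of positions. Phrased as a disjunction, it
-- consults `R` only where `x` and `y` differ, so `R` has to be correct only on positions of bits of
-- `x` or `y`.
Lex : ℕ → (ℕ → ℕ → Set) → ℕ → ℕ → Set
Lex n R x y = ∃[ k ≤ n ] (y at k ≡ true × ¬ (x at k ≡ true) ×
                (∀[ l ≤ n ] (l ≡ k ⊎ R l k ⊎ (x at l ≡ y at l))))

Occurs : ℕ → ℕ → ℕ → Set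
Occurs x y k = x at k ≡ true ⊎ y at k ≡ true

differ⇒occurs : ∀ {x y} k → x at k ≢ y at k → Occurs x y k
differ⇒occurs {x} {y} k ne with x at k | y at k
... | true | _ = inj₁ refl
... | false | true = inj₂ refl
... | false | false = contradiction refl ne

module _ {n x y : ℕ} {R : ℕ → ℕ → Set} (x≤n : x ≤ n) (y≤n : y ≤ n)
         (R-< : ∀ {k l} → Occurs x y k → Occurs x y l → R l k ⇔ (l < k)) where

  occurs≤ : ∀ {k} → Occurs x y k → k ≤ n
  occurs≤ (inj₁ e) = ≤-trans (<⇒≤ (at-true⇒< _ e)) x≤n
  occurs≤ (inj₂ e) = ≤-trans (<⇒≤ (at-true⇒< _ e)) y≤n

  Lex⇔< : Lex n R x y ⇔ (x < y)
  Lex⇔< = mk⇔ ltr rtl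
    where
    ltr : Lex n R x y → x < y
    ltr (k , k≤n , ey , ex , f) = BitLess⇒< (k , ey , ≢true⇒false ex , above)
      where
      above : ∀ l → k < l → x at l ≡ y at l
      above l k<l with x at l ≟ᴮ y at l
      ... | yes e = e
      ... | no ne with f l (occurs≤ (differ⇒occurs l ne))
      ...   | inj₁ refl = contradiction k<l (<-irrefl refl)
      ...   | inj₂ (inj₁ r) = contradiction (to (R-< (inj₂ ey) (differ⇒occurs l ne)) r) (<⇒≯ k<l)
      ...   | inj₂ (inj₂ e) = e
    rtl : x < y → Lex n R x y
    rtl x<y = let (k , ey , ex , f) = <⇒BitLess x<y in
      k , occurs≤ (inj₂ ey) , ey , (λ e → true≢false e ex) , λ l _ → trichotomy k ey f l
      where
      trichotomy : ∀ k → y at k ≡ true → (∀ l → k < l → x at l ≡ y at l) → ∀ l → l ≡ k ⊎ R l k ⊎ (x at l ≡ y at l)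
      trichotomy k ey f l with <-cmp l k
      ... | tri≈ _ e _ = inj₁ e
      ... | tri> _ _ k<l = inj₂ (inj₂ (f l k<l))
      ... | tri< l<k _ _ with x at l ≟ᴮ y at l
      ...   | yes e = inj₂ (inj₂ e)
      ...   | no ne = inj₂ (inj₁ (from (R-< (inj₂ ey) (differ⇒occurs l ne)) l<k))

-- A number W codes a family of sets of numbers; when these are initial segments, they order their elements.
Separates : ℕ → ℕ → ℕ → ℕ → Set
Separates n W i j = ∃[ w ≤ n ] (W at w ≡ true × w at i ≡ true × ¬ (w at j ≡ true))

-- A test that does not mention the order. Comparing `i` and `j` refers to their bit positions,
-- which are smaller numbers and again in `D`; this recursion is well founded, so `<` is its only
-- solution on `D`.
Good : ℕ → ℕ → ℕ → Set
Good n W D = (∀[ i ≤ n ] (D at i ≡ true → ∀[ k ≤ n ] (i at k ≡ true → D at k ≡ true))) ×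
  (∀[ i ≤ n ] ∀[ j ≤ n ] (D at i ≡ true → D at j ≡ true → Separates n W i j ⇔ Lex n (Separates n W) i j))

Covers : ℕ → ℕ → ℕ → Set
Covers n D x = ∀[ i ≤ n ] (x at i ≡ true → ∀[ k ≤ n ] (i at k ≡ true → D at k ≡ true))

BitLess₂ : ℕ → ℕ → ℕ → Set
BitLess₂ n x y = ∃[ W ≤ n ] ∃[ D ≤ n ] (Good n W D × Covers n D x × Covers n D y × Lex n (Lex n (Separates n W)) x y)

module _ {n W D : ℕ} where
  OrdersDomain : Set
  OrdersDomain = ∀ {i j} → D at i ≡ true → D at j ≡ true → Separates n W i j ⇔ (i < j)

  good⇒orders : D ≤ n → Good n W D → OrdersDomain
  good⇒orders D≤n (closed , rec) {i} {j} di dj = go (suc (i + j)) (s≤s (m≤m+n i j)) (s≤s (m≤n+m j i)) di dj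
    where
    in-D : ∀ {i} → D at i ≡ true → i ≤ n
    in-D di = ≤-trans (<⇒≤ (at-true⇒< _ di)) D≤n
    go : ∀ N {i j} → i < N → j < N → D at i ≡ true → D at j ≡ true → Separates n W i j ⇔ (i < j)
    go (suc N) {i} {j} i<N j<N di dj = ⇔-trans (rec i (in-D di) j (in-D dj) di dj)
      (Lex⇔< (in-D di) (in-D dj) λ ok ol → go N (below ol) (below ok) (member ol) (member ok))
      where
      below : ∀ {k} → Occurs i j k → k < N
      below (inj₁ e) = <-≤-trans (at-true⇒< _ e) (≤-pred i<N)
      below (inj₂ e) = <-≤-trans (at-true⇒< _ e) (≤-pred j<N)
      member : ∀ {k} → Occurs i j k → D at k ≡ true
      member (inj₁ e) = closed i (in-D di) di _ (≤-trans (<⇒≤ (at-true⇒< _ e)) (in-D di)) e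
      member (inj₂ e) = closed j (in-D dj) dj _ (≤-trans (<⇒≤ (at-true⇒< _ e)) (in-D dj)) e

  orders⇒Lex₂ : OrdersDomain → ∀ {x y} → x ≤ n → y ≤ n → Covers n D x → Covers n D y →
                Lex n (Lex n (Separates n W)) x y ⇔ (x < y)
  orders⇒Lex₂ orders {x} {y} x≤n y≤n cx cy =
    Lex⇔< x≤n y≤n λ ok ol → Lex⇔< (occ ol) (occ ok)
      λ ok′ ol′ → orders (member ol ok ol′) (member ol ok ok′)
    where
    occ : ∀ {k} → Occurs x y k → k ≤ n
    occ (inj₁ e) = ≤-trans (<⇒≤ (at-true⇒< _ e)) x≤n
    occ (inj₂ e) = ≤-trans (<⇒≤ (at-true⇒< _ e)) y≤n
    bits : ∀ {i k} → Occurs x y i → i at k ≡ true → D at k ≡ true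
    bits o@(inj₁ e) ek = cx _ (occ o) e _ (≤-trans (<⇒≤ (at-true⇒< _ ek)) (occ o)) ek
    bits o@(inj₂ e) ek = cy _ (occ o) e _ (≤-trans (<⇒≤ (at-true⇒< _ ek)) (occ o)) ek
    member : ∀ {i j k} → Occurs x y i → Occurs x y j → Occurs i j k → D at k ≡ true
    member oi oj (inj₁ e) = bits oi e
    member oi oj (inj₂ e) = bits oj e

ones : ℕ → ℕ
ones k = fromBits (λ _ → true) k

∈ones : ∀ {k i} → (ones k at i ≡ true) ⇔ (i < k)
∈ones = mk⇔ (λ e → proj₁ (fromBits-true _ e)) (fromBits-at _)

-- If K is the top bit of the top bit of y, the initial segments of {0,…,K} are coded by a number below 2^2^K ≤ y.
module InitialSegments {n K : ℕ} (fits : 2 ^ 2 ^ K ≤ n) where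
  open Comprehension (λ w → anyUpTo? (λ k → w ≟ ones (suc k)) K) (2 ^ K) public renaming (set to W)

  D : ℕ
  D = ones (suc K)

  W≤n : W ≤ n
  W≤n = ≤-trans (<⇒≤ set<) fits

  D≤n : D ≤ n
  D≤n = ≤-trans (<⇒≤ (fromBits< _ (suc K))) (≤-trans (^-monoʳ-≤ 2 (n<2^n K)) fits)

  orders : ∀ {i j} → D at i ≡ true → D at j ≡ true → Separates n W i j ⇔ (i < j)
  orders {i} {j} di dj = mk⇔ ltr rtl
    where
    ltr : Separates n W i j → i < j
    ltr (w , _ , w∈W , i∈w , j∉w) with to (∈set {w}) w∈W
    ... | _ , k , k<K , refl = <-≤-trans (to (∈ones {suc k}) i∈w) (≮⇒≥ λ j<k → j∉w (from ∈ones j<k))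
    rtl : i < j → Separates n W i j
    -- The segment from 0 to `i` separates. As `i < j ≤ K`, only segments ending before `K` are
    -- needed; their codes are below `2 ^ K`, so `W` stays below `2 ^ 2 ^ K`.
    rtl i<j = ones (suc i) , ≤-trans (<⇒≤ (fromBits< _ (suc i))) (≤-trans (^-monoʳ-≤ 2 (<-trans i<K (n<2^n K))) fits) ,
        from ∈set (<-≤-trans (fromBits< _ (suc i)) (^-monoʳ-≤ 2 i<K) , i , i<K , refl) ,
        from ∈ones ≤-refl , λ j∈ → <-irrefl refl (<-≤-trans i<j (≤-pred (to (∈ones {suc i}) j∈)))
      where
      i<K : i < K
      i<K = <-≤-trans i<j (≤-pred (to (∈ones {suc K}) dj))

  good : Good n W D
  good = closed , λ i i≤n j j≤n di dj → ⇔-trans (orders di dj)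
    (⇔-sym (Lex⇔< i≤n j≤n λ ok ol → orders (occ di dj ol) (occ di dj ok)))
    where
    closed : ∀[ i ≤ n ] (D at i ≡ true → ∀[ k ≤ n ] (i at k ≡ true → D at k ≡ true))
    closed i _ di k _ e = from ∈ones (<-trans (at-true⇒< k e) (to (∈ones {suc K}) di))
    occ : ∀ {i j k} → D at i ≡ true → D at j ≡ true → Occurs i j k → D at k ≡ true
    occ di dj (inj₁ e) = closed _ (≤-trans (<⇒≤ (at-true⇒< _ di)) D≤n) di _ (≤-trans (<⇒≤ (<-trans (at-true⇒< _ e) (at-true⇒< _ di))) D≤n) e
    occ di dj (inj₂ e) = closed _ (≤-trans (<⇒≤ (at-true⇒< _ dj)) D≤n) dj _ (≤-trans (<⇒≤ (<-trans (at-true⇒< _ e) (at-true⇒< _ dj))) D≤n) e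

BitLess₂⇔< : ∀ {n x y} → x ≤ n → y ≤ n → BitLess₂ n x y ⇔ (x < y)
BitLess₂⇔< {n} {x} {y} x≤n y≤n = mk⇔
  (λ (W , _ , D , D≤n , good , cx , cy , l) → to (orders⇒Lex₂ (good⇒orders D≤n good) x≤n y≤n cx cy) l)
  (λ x<y → let (i , lo , hi) = topBit y (≤-<-trans z≤n x<y) in complete x<y i lo hi)
  where
  complete : x < y → ∀ i → 2 ^ i ≤ y → y < 2 ^ suc i → BitLess₂ n x y
  -- Here `x` is 0 and `y` is 1. The only position is 0, which has no bits itself, so empty `W` and
  -- `D` suffice.
  complete x<y zero lo hi = 0 , z≤n , 0 , z≤n ,
      ((λ i _ e → contradiction (zero-at i) (true≢false e)) , λ i _ j _ e → contradiction (zero-at i) (true≢false e)) ,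
      covers (<-trans x<y hi) , covers hi , from (orders⇒Lex₂ {W = 0} {D = 0} (λ e → contradiction (zero-at _) (true≢false e)) x≤n y≤n (covers (<-trans x<y hi)) (covers hi)) x<y
    where
    covers : ∀ {z} → z < 2 → Covers n 0 z
    covers z<2 zero _ _ k _ e = contradiction (zero-at k) (true≢false e)
    covers z<2 (suc i) _ e = contradiction (at-< (suc i) (<-≤-trans z<2 (^-monoʳ-≤ 2 (s≤s (z≤n {i}))))) (true≢false e)
  complete x<y i@(suc _) lo hi with topBit i (s≤s z≤n)
  ... | K , loK , hiK = W , W≤n , D , D≤n , good , covers (<-trans x<y hi) , covers hi ,
      from (orders⇒Lex₂ orders x≤n y≤n (covers (<-trans x<y hi)) (covers hi)) x<y
    where
    open InitialSegments {n} {K} (≤-trans (^-monoʳ-≤ 2 loK) (≤-trans lo y≤n))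
    covers : ∀ {z} → z < 2 ^ suc i → Covers n D z
    covers z< j _ ej k _ ek = from ∈ones (2^-cancel-<
      (≤-<-trans (≤-trans (at-true⇒≤ k ek) (≤-pred (2^-cancel-< (≤-<-trans (at-true⇒≤ j ej) z<)))) hiK))

pattern v0 = zero
pattern v1 = suc zero
pattern v2 = suc (suc zero)
pattern v3 = suc (suc (suc zero))
pattern v4 = suc (suc (suc (suc zero)))
pattern s1 i = suc i
pattern s2 i = suc (suc i)
pattern s3 i = suc (suc (suc i))
pattern s4 i = suc (suc (suc (suc i)))
pattern s5 i = suc (suc (suc (suc (suc i))))

module OrderDefinability (ℓ : NumPreds)
  (dec : ∀ {k} (P : NumPreds.Sym ℓ k) xs → Dec (NumPreds.⟦_⟧ₙ ℓ P xs))
  (<ᵈ : ∀ {k} (x y : Fin k) → FO.Def ℓ dec (λ n ρ → ρ ! x < ρ ! y)) where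
  open FO ℓ dec

  private
    variable
      k : ℕ

  zeroᵈ : (x : Fin k) → Def (λ n ρ → ρ ! x ≡ 0)
  zeroᵈ x = reformulate (¬ᵈ (∃ᵈ <ᵈ v0 (s1 x)))
    λ {n} {ρ} B → mk⇔ (λ f → n<1⇒n≡0 (≰⇒> λ 0<x → f (0 , z≤n , 0<x)))
                      (λ { e (a , _ , a<) → n≮0 (subst (a <_) e a<) })

  ≤ᵈ : (x y : Fin k) → Def (λ n ρ → ρ ! x ≤ ρ ! y)
  ≤ᵈ x y = reformulate (¬ᵈ <ᵈ y x) λ _ → mk⇔ ≮⇒≥ ≤⇒≯

  sucᵈ : (x y : Fin k) → Def (λ n ρ → suc (ρ ! x) ≡ ρ ! y)
  sucᵈ x y = reformulate (<ᵈ x y ∧ᵈ (¬ᵈ (∃ᵈ <ᵈ (s1 x) v0 ∧ᵈ <ᵈ v0 (s1 y))))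
    λ {n} {ρ} B → mk⇔
      (λ (x<y , none) → ≤-antisym x<y (≮⇒≥ λ sx<y → none (suc (ρ ! x) , ≤-trans (<⇒≤ sx<y) (B y) , ≤-refl , sx<y)))
      (λ e → ≤-reflexive e , λ (a , _ , x<a , a<y) → <⇒≱ a<y (≤-trans (≤-reflexive (sym e)) x<a))

  constᵈ : ∀ c (x : Fin k) → Def (λ n ρ → ρ ! x ≡ c)
  constᵈ zero x = zeroᵈ x
  constᵈ (suc c) x = reformulate (∃ᵈ constᵈ c v0 ∧ᵈ sucᵈ v0 (s1 x))
    λ {n} {ρ} B → mk⇔ (λ { (_ , _ , refl , e) → sym e }) (λ e → c , ≤-trans (n≤1+n c) (subst (_≤ n) e (B x)) , refl , sym e)

decLBit : ∀ {k} (P : SymBit k) xs → Dec (⟦ P ⟧Bit xs)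
decLBit bit (a ∷ i ∷ []) = ¬? (2 ∣? shr a i)

module BitOrder where
  open FO LBit decLBit

  private
    variable
      k : ℕ

  atᵈ : (a i : Fin k) → DefB (λ n ρ → (ρ ! a) at (ρ ! i))
  atᵈ a i = reformulate (atomᵈ bit (a ∷ i ∷ [])) λ {n} {ρ} _ → Bit⇔at (ρ ! a) (ρ ! i)

  lexᵈ : {R : ℕ → ℕ → ℕ → ℕ → Set} →
         (∀ {k} (W i j : Fin k) → Def (λ n ρ → R n (ρ ! W) (ρ ! i) (ρ ! j))) →
         (W i j : Fin k) → Def (λ n ρ → Lex n (R n (ρ ! W)) (ρ ! i) (ρ ! j))
  lexᵈ Rᵈ W i j = ∃ᵈ atᵈ (s1 j) v0 ∧ᵈ (¬ᵈ atᵈ (s1 i) v0) ∧ᵈ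
    (∀ᵈ eqᵈ v0 v1 ∨ᵈ Rᵈ (s2 W) v0 v1 ∨ᵈ ≡ᵇ (atᵈ (s2 i) v0) (atᵈ (s2 j) v0))

  separatesᵈ : (W i j : Fin k) → Def (λ n ρ → Separates n (ρ ! W) (ρ ! i) (ρ ! j))
  separatesᵈ W i j = ∃ᵈ atᵈ (s1 W) v0 ∧ᵈ atᵈ v0 (s1 i) ∧ᵈ (¬ᵈ atᵈ v0 (s1 j))

  goodᵈ : (W D : Fin k) → Def (λ n ρ → Good n (ρ ! W) (ρ ! D))
  goodᵈ W D = (∀ᵈ atᵈ (s1 D) v0 ⇒ᵈ (∀ᵈ atᵈ v1 v0 ⇒ᵈ atᵈ (s2 D) v0)) ∧ᵈ
    (∀ᵈ ∀ᵈ atᵈ (s2 D) v1 ⇒ᵈ atᵈ (s2 D) v0 ⇒ᵈ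
      (separatesᵈ (s2 W) v1 v0 ⇔ᵈ lexᵈ {R = Separates} separatesᵈ (s2 W) v1 v0))

  coversᵈ : (D x : Fin k) → Def (λ n ρ → Covers n (ρ ! D) (ρ ! x))
  coversᵈ D x = ∀ᵈ atᵈ (s1 x) v0 ⇒ᵈ (∀ᵈ atᵈ v1 v0 ⇒ᵈ atᵈ (s2 D) v0)

  <ᵈ : (x y : Fin k) → Def (λ n ρ → ρ ! x < ρ ! y)
  <ᵈ x y = reformulate
    (∃ᵈ ∃ᵈ goodᵈ v1 v0 ∧ᵈ coversᵈ v0 (s2 x) ∧ᵈ coversᵈ v0 (s2 y) ∧ᵈ
      lexᵈ {R = λ n W → Lex n (Separates n W)} (lexᵈ {R = Separates} separatesᵈ) v1 (s2 x) (s2 y))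
    (λ B → BitLess₂⇔< (B x) (B y))

-- Columns and rows

tri-suc : ∀ i → tri (suc i) ≡ tri i + suc i
tri-suc i = trans (cong (_/ 2) (expand i)) (trans (+-distrib-/-∣ʳ (i * suc i) (divides-refl (suc i)))
  (cong (tri i +_) (m*n/n≡m (suc i) 2)))
  where
  expand : ∀ i → suc i * suc (suc i) ≡ i * suc i + suc i * 2
  expand = solve-∀

tri-mono-≤ : ∀ {i j} → i ≤ j → tri i ≤ tri j
tri-mono-≤ {zero} _ = z≤n
tri-mono-≤ {suc i} {suc j} (s≤s i≤j) = subst₂ _≤_ (sym (tri-suc i)) (sym (tri-suc j)) (+-mono-≤ (tri-mono-≤ i≤j) (s≤s i≤j))

n≤tri : ∀ i → i ≤ tri i
n≤tri zero = z≤n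
n≤tri (suc i) = subst (suc i ≤_) (sym (tri-suc i)) (m≤n+m (suc i) (tri i))

maxSat-true : ∀ (p : ℕ → Bool) b → p 0 ≡ true → p (maxSat p b) ≡ true
maxSat-true p zero p0 = p0
maxSat-true p (suc b) p0 with p (suc b) in e
... | true = e
... | false = maxSat-true p b p0

maxSat-false : ∀ (p : ℕ → Bool) b {j} → maxSat p b < j → j ≤ b → p j ≡ false
maxSat-false p zero below z≤n = contradiction below n≮0
maxSat-false p (suc b) below j≤ with p (suc b) in e
... | true = contradiction j≤ (<⇒≱ below)
... | false with m≤n⇒m<n∨m≡n j≤
...   | inj₁ j<sb = maxSat-false p b below (≤-pred j<sb)
...   | inj₂ refl = e

bot≤ : ∀ x → tri (col x) ≤ x
bot≤ x = ≤ᵇ⇒≤ _ _ (from T-≡ (maxSat-true (λ i → tri i ≤ᵇ x) x refl))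

<next-bot : ∀ x → x < tri (suc (col x))
<next-bot x = ≰⇒> λ le → contradiction (trans (sym (to T-≡ (≤⇒≤ᵇ le)))
  (maxSat-false (λ i → tri i ≤ᵇ x) x ≤-refl (≤-trans (n≤tri (suc (col x))) le))) λ ()

Position : ℕ → ℕ → ℕ → Set
Position x c r = tri c + r ≡ x × r ≤ c

position : ∀ x → Position x (col x) (row x)
position x = m+[n∸m]≡n (bot≤ x) ,
  ≤-pred (+-cancelˡ-< (tri (col x)) _ _ (subst₂ _<_ (sym (m+[n∸m]≡n (bot≤ x))) (tri-suc (col x)) (<next-bot x)))

col-unique : ∀ {x c} → tri c ≤ x → x < tri (suc c) → col x ≡ c
col-unique {x} {c} lo hi with <-cmp (col x) c
... | tri< below _ _ = contradiction (<-≤-trans (<next-bot x) (≤-trans (tri-mono-≤ below) lo)) (<-irrefl refl)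
... | tri≈ _ e _ = e
... | tri> _ _ gt = contradiction (<-≤-trans hi (≤-trans (tri-mono-≤ gt) (bot≤ x))) (<-irrefl refl)

position-unique : ∀ {x c r} → Position x c r → col x ≡ c × row x ≡ r
position-unique {x} {c} {r} (refl , r≤c) = c≡ , trans (cong (λ c′ → tri c + r ∸ tri c′) c≡) (m+n∸m≡n (tri c) r)
  where
  c≡ : col x ≡ c
  c≡ = col-unique (m≤m+n (tri c) r) (subst (tri c + r <_) (sym (tri-suc c)) (+-monoʳ-< (tri c) (s≤s r≤c)))

col≤ : ∀ x → col x ≤ x
col≤ x = ≤-trans (n≤tri (col x)) (bot≤ x)

row≤col : ∀ x → row x ≤ col x
row≤col x = proj₂ (position x)

col-mono : ∀ {x y} → x ≤ y → col x ≤ col y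
col-mono {x} {y} x≤y = ≮⇒≥ λ below → <⇒≱ (<next-bot y) (≤-trans (≤-trans (tri-mono-≤ below) (bot≤ x)) x≤y)

-- Bit is definable from <, ⊏, C and Q

next-position : ∀ p → (row p < col p × col (suc p) ≡ col p × row (suc p) ≡ suc (row p)) ⊎
                      (row p ≡ col p × col (suc p) ≡ suc (col p) × row (suc p) ≡ 0)
next-position p with m≤n⇒m<n∨m≡n (row≤col p)
... | inj₁ r<c = inj₁ (r<c , position-unique (trans (+-suc (tri (col p)) (row p)) (cong suc (proj₁ (position p))) , r<c))
... | inj₂ r≡c = inj₂ (r≡c , position-unique (trans (+-identityʳ _) (trans (tri-suc (col p))
      (trans (+-suc (tri (col p)) (col p)) (cong suc (trans (cong (tri (col p) +_) (sym r≡c)) (proj₁ (position p)))))) , z≤n))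

col-zero : ∀ {x} → col x ≡ 0 → x ≡ 0
col-zero {x} e = trans (sym (proj₁ (position x))) (cong₂ (λ c r → tri c + r) e (n≤0⇒n≡0 (subst (row x ≤_) e (row≤col x))))

position-≤ : ∀ {x c r} → c ≤ col x → r ≤ row x → tri c + r ≤ x
position-≤ {x} c≤ r≤ = subst (_ ≤_) (proj₁ (position x)) (+-mono-≤ (tri-mono-≤ c≤) r≤)

position-<col : ∀ {x c r} → r ≤ c → c < col x → tri c + r < tri (col x)
position-<col {x} {c} {r} r≤c c<col = begin-strict
  tri c + r       <⟨ +-monoʳ-< (tri c) (s≤s r≤c) ⟩
  tri c + suc c   ≡⟨ sym (tri-suc c) ⟩
  tri (suc c)     ≤⟨ tri-mono-≤ c<col ⟩
  tri (col x)     ∎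
  where open ≤-Reasoning

-- The reason why a column has room for its numbers: all bits of `tri (suc c)` are at positions up
-- to `c`, which are exactly the rows of column `c`.
tri<2^ : ∀ c → tri c < 2 ^ c
tri<2^ zero = s≤s z≤n
tri<2^ (suc c) = subst₂ _<_ (sym (tri-suc c)) (cong (2 ^ c +_) (sym (+-identityʳ _))) (+-mono-<-≤ (tri<2^ c) (n<2^n c))

module RowDefinability where
  decLSCQ : ∀ {k} (P : SymLSCQ k) xs → Dec (⟦ P ⟧LSCQ xs)
  decLSCQ lt (x ∷ y ∷ []) = x <? y
  decLSCQ sq (x ∷ y ∷ []) = (row x <? row y) ⊎-dec ((row x ≟ row y) ×-dec (col x <? col y))
  decLSCQ cC (x ∷ []) = ¬? (2 ∣? _)
  decLSCQ qQ (x ∷ []) = ¬? (2 ∣? _)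

  open FO LSCQ decLSCQ

  private
    variable
      k : ℕ

  <ᵈ : (x y : Fin k) → Def (λ n ρ → ρ ! x < ρ ! y)
  <ᵈ x y = atomᵈ lt (x ∷ y ∷ [])

  ⊏ᵈ : (x y : Fin k) → Def (λ n ρ → (ρ ! x) ⊏ (ρ ! y))
  ⊏ᵈ x y = atomᵈ sq (x ∷ y ∷ [])

  open OrderDefinability LSCQ decLSCQ <ᵈ

  -- Inside a column the row grows by one from `p` to `suc p`; at a bottom it drops to 0 from the
  -- last row of the previous column. That row is positive unless the previous column is column 0,
  -- whence the separate case 1.
  bottomᵈ : (x : Fin k) → Def (λ n ρ → row (ρ ! x) ≡ 0)
  bottomᵈ x = reformulate (constᵈ 0 x ∨ᵈ constᵈ 1 x ∨ᵈ (∃ᵈ sucᵈ v0 (s1 x) ∧ᵈ ⊏ᵈ (s1 x) v0))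
    λ {n} {ρ} B → mk⇔ ltr (rtl (B x))
    where
    ltr : ∀ {n x} → x ≡ 0 ⊎ x ≡ 1 ⊎ (∃[ p ≤ n ] (suc p ≡ x × x ⊏ p)) → row x ≡ 0
    ltr (inj₁ refl) = refl
    ltr (inj₂ (inj₁ refl)) = refl
    ltr (inj₂ (inj₂ (p , _ , refl , below))) with next-position p
    ... | inj₂ (_ , _ , r0) = r0
    ... | inj₁ (_ , _ , rs) with below
    ...   | inj₁ r< = contradiction (subst (_< row p) rs r<) (≤⇒≯ (n≤1+n _))
    ...   | inj₂ (r≡ , _) = contradiction (trans (sym rs) r≡) (>⇒≢ ≤-refl)
    rtl : ∀ {n x} → x ≤ n → row x ≡ 0 → x ≡ 0 ⊎ x ≡ 1 ⊎ (∃[ p ≤ n ] (suc p ≡ x × x ⊏ p))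
    rtl {x = zero} _ _ = inj₁ refl
    rtl {x = suc zero} _ _ = inj₂ (inj₁ refl)
    rtl {x = suc p@(suc _)} x≤n r0 with next-position p
    ... | inj₁ (_ , _ , rs) = contradiction (trans (sym rs) r0) λ ()
    ... | inj₂ (r≡c , _ , _) = inj₂ (inj₂ (p , ≤-trans (n≤1+n p) x≤n , refl ,
          inj₁ (subst₂ _<_ (sym r0) (sym r≡c) (n≢0⇒n>0 λ c0 → contradiction (col-zero {p} c0) λ ()))))

  -- Let `x` be in row r > 0 of column c, so that `p` is in row r - 1 of the same column. The
  -- numbers below `x` that are between `p` and `x` in `⊏` are those in row r of an earlier column,
  -- and there is none exactly when r = c.
  DiagonalFormula : ℕ → ℕ → Set
  DiagonalFormula n x = x ≡ 0 ⊎ (¬ (row x ≡ 0) × (∃[ p ≤ n ] (suc p ≡ x × ¬ (∃[ z ≤ n ] (z < x × p ⊏ z × z ⊏ x)))))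

  diagonalᵈ : (x : Fin k) → Def (λ n ρ → row (ρ ! x) ≡ col (ρ ! x))
  diagonalᵈ x = reformulate
    (zeroᵈ x ∨ᵈ (¬ᵈ bottomᵈ x) ∧ᵈ (∃ᵈ sucᵈ v0 (s1 x) ∧ᵈ (¬ᵈ (∃ᵈ <ᵈ v0 (s2 x) ∧ᵈ ⊏ᵈ v1 v0 ∧ᵈ ⊏ᵈ v0 (s2 x)))))
    λ {n} {ρ} B → mk⇔ (ltr (B x)) (rtl (B x))
    where
    ltr : ∀ {n x} → x ≤ n → DiagonalFormula n x → row x ≡ col x
    ltr _ (inj₁ refl) = refl
    ltr {x = x} x≤n (inj₂ (r≢0 , p , _ , refl , none)) with next-position p
    ... | inj₂ (_ , _ , r0) = contradiction r0 r≢0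
    ... | inj₁ (_ , _ , rs) = ≤-antisym (row≤col x) (≮⇒≥ λ r<c → absurd (col x) refl r<c)
      where
      absurd : ∀ c → col x ≡ c → row x < c → ⊥
      absurd (suc c) ec r<c = none (z , ≤-trans (<⇒≤ z<x) x≤n , z<x ,
          inj₁ (subst (row p <_) (sym (trans (proj₂ zpos) rs)) ≤-refl) ,
          inj₂ (proj₂ zpos , subst₂ _<_ (sym (proj₁ zpos)) (sym ec) ≤-refl))
        where
        z : ℕ
        z = tri c + row x
        zpos : col z ≡ c × row z ≡ row x
        zpos = position-unique (refl , ≤-pred r<c)
        z<x : z < x
        z<x = <-≤-trans (position-<col {x} (≤-pred r<c) (subst (c <_) (sym ec) ≤-refl)) (bot≤ x)
    rtl : ∀ {n x} → x ≤ n → row x ≡ col x → DiagonalFormula n x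
    rtl {x = zero} _ _ = inj₁ refl
    rtl {x = x@(suc p)} x≤n r≡c with next-position p
    ... | inj₂ (_ , cs , r0) = contradiction (trans (sym cs) (trans (sym r≡c) r0)) λ ()
    ... | inj₁ (_ , cs , rs) = inj₂ ((λ r0 → contradiction (trans (sym rs) r0) λ ()) , p , ≤-trans (n≤1+n p) x≤n , refl , none)
      where
      none : ¬ (∃[ z ≤ _ ] (z < x × p ⊏ z × z ⊏ x))
      none (z , _ , z<x , inj₁ rp<rz , inj₁ rz<rx) = <⇒≱ rz<rx (subst (_≤ row z) (sym rs) rp<rz)
      none (z , _ , z<x , inj₁ _ , inj₂ (rz≡rx , cz<cx)) = <⇒≱ cz<cx (subst (_≤ col z) (trans rz≡rx r≡c) (row≤col z))
      none (z , _ , z<x , inj₂ (_ , cp<cz) , _) = <⇒≱ cp<cz (subst (col z ≤_) cs (col-mono (<⇒≤ z<x)))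

  -- A diagonal element is the `⊏`-least element of its row, so it marks the boundary between this
  -- row and all lower ones; the witness is the diagonal element of the row of `y`.
  row<ᵈ : (x y : Fin k) → Def (λ n ρ → row (ρ ! x) < row (ρ ! y))
  row<ᵈ x y = reformulate (∃ᵈ diagonalᵈ v0 ∧ᵈ ⊏ᵈ (s1 x) v0 ∧ᵈ (eqᵈ v0 (s1 y) ∨ᵈ ⊏ᵈ v0 (s1 y)))
    λ {n} {ρ} B → mk⇔ (λ (z , _ , d , x⊏z , z⊑y) → ltr (ρ ! x) (ρ ! y) z d x⊏z z⊑y) (rtl {x = ρ ! x} (B y))
    where
    ltr : ∀ x y z → row z ≡ col z → x ⊏ z → z ≡ y ⊎ z ⊏ y → row x < row y
    ltr x y z d x⊏z z⊑y = <-≤-trans (first x⊏z) (second z⊑y)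
      where
      first : x ⊏ z → row x < row z
      first (inj₁ r<) = r<
      first (inj₂ (r≡ , c<)) = contradiction (subst (_≤ col x) (trans r≡ d) (row≤col x)) (<⇒≱ c<)
      second : z ≡ y ⊎ z ⊏ y → row z ≤ row y
      second (inj₁ refl) = ≤-refl
      second (inj₂ (inj₁ r<)) = <⇒≤ r<
      second (inj₂ (inj₂ (r≡ , _))) = ≤-reflexive r≡
    rtl : ∀ {n x y} → y ≤ n → row x < row y → ∃[ z ≤ n ] (row z ≡ col z × x ⊏ z × (z ≡ y ⊎ z ⊏ y))
    rtl {n} {x} {y} y≤n r< = z , ≤-trans (position-≤ {y} (row≤col y) ≤-refl) y≤n , trans (proj₂ zpos) (sym (proj₁ zpos)) ,
        inj₁ (subst (row x <_) (sym (proj₂ zpos)) r<) , z⊑y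
      where
      z : ℕ
      z = tri (row y) + row y
      zpos : col z ≡ row y × row z ≡ row y
      zpos = position-unique (refl , ≤-refl)
      z⊑y : z ≡ y ⊎ z ⊏ y
      z⊑y with m≤n⇒m<n∨m≡n (row≤col y)
      ... | inj₁ r<c = inj₂ (inj₂ (proj₂ zpos , subst (_< col y) (sym (proj₁ zpos)) r<c))
      ... | inj₂ r≡c = inj₁ (trans (cong (λ c → tri c + row y) r≡c) (proj₁ (position y)))

  row≡ᵈ : (x y : Fin k) → Def (λ n ρ → row (ρ ! x) ≡ row (ρ ! y))
  row≡ᵈ x y = reformulate ((¬ᵈ row<ᵈ x y) ∧ᵈ (¬ᵈ row<ᵈ y x))
    λ _ → mk⇔ (λ (a , b) → ≤-antisym (≮⇒≥ b) (≮⇒≥ a)) (λ e → <-irrefl e , <-irrefl (sym e))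

  col<ᵈ : (x y : Fin k) → Def (λ n ρ → col (ρ ! x) < col (ρ ! y))
  col<ᵈ x y = reformulate (∃ᵈ bottomᵈ v0 ∧ᵈ <ᵈ (s1 x) v0 ∧ᵈ ≤ᵈ v0 (s1 y))
    λ {n} {ρ} B → mk⇔ (λ (b , _ , r0 , x<b , b≤y) → ltr (ρ ! x) (ρ ! y) b r0 x<b b≤y) (rtl {x = ρ ! x} (B y))
    where
    ltr : ∀ x y b → row b ≡ 0 → x < b → b ≤ y → col x < col y
    ltr x y b r0 x<b b≤y = <-≤-trans (≰⇒> λ cb≤cx → <⇒≱ x<b (≤-trans
      (≤-reflexive (trans (sym (proj₁ (position b))) (trans (cong (tri (col b) +_) r0) (+-identityʳ _))))
      (≤-trans (tri-mono-≤ cb≤cx) (bot≤ x)))) (col-mono b≤y)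
    rtl : ∀ {n x y} → y ≤ n → col x < col y → ∃[ b ≤ n ] (row b ≡ 0 × x < b × b ≤ y)
    rtl {n} {x} {y} y≤n c< = tri (col y) , ≤-trans (bot≤ y) y≤n , proj₂ (position-unique {c = col y} (+-identityʳ (tri (col y)) , z≤n)) ,
      <-≤-trans (<next-bot x) (tri-mono-≤ c<) , bot≤ y

  suc-colᵈ : (x y : Fin k) → Def (λ n ρ → suc (col (ρ ! x)) ≡ col (ρ ! y))
  suc-colᵈ x y = reformulate (col<ᵈ x y ∧ᵈ (¬ᵈ (∃ᵈ col<ᵈ (s1 x) v0 ∧ᵈ col<ᵈ v0 (s1 y))))
    λ {n} {ρ} B → mk⇔ (λ (c< , none) → ltr {x = ρ ! x} (B y) c< none)
      (λ e → ≤-reflexive e , λ (z , _ , cx<cz , cz<cy) → <⇒≱ cz<cy (≤-trans (≤-reflexive (sym e)) cx<cz))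
    where
    ltr : ∀ {n x y} → y ≤ n → col x < col y → ¬ (∃[ z ≤ n ] (col x < col z × col z < col y)) → suc (col x) ≡ col y
    ltr {n} {x} {y} y≤n c< none = ≤-antisym c< (≮⇒≥ λ sc< → none (tri (suc (col x)) ,
      ≤-trans (tri-mono-≤ c<) (≤-trans (bot≤ y) y≤n) ,
      subst (col x <_) (sym colz) ≤-refl , subst (_< col y) (sym colz) sc<))
      where
      colz : col (tri (suc (col x))) ≡ suc (col x)
      colz = proj₁ (position-unique {c = suc (col x)} (+-identityʳ (tri (suc (col x))) , z≤n))

  -- Positions are represented by elements of the row with that number; column c stores the bits of c + 1 and q_{c+1}.
  bot-bitᵈ : (a d : Fin k) → DefB (λ n ρ → tri (col (ρ ! a)) at row (ρ ! d))
  bot-bitᵈ a d = reformulate (∃ᵈ suc-colᵈ v0 (s1 a) ∧ᵈ row≡ᵈ v0 (s1 d) ∧ᵈ atomᵈ qQ (v0 ∷ []))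
    λ {n} {ρ} B → mk⇔ (λ (x , _ , ec , er , q) → subst₂ (λ c r → tri c at r ≡ true) ec er (to (Bit⇔at (tri (suc (col x))) (row x)) q))
                      (rtl (B a) (col (ρ ! a)) refl)
    where
    rtl : ∀ {n a r} → a ≤ n → ∀ c → col a ≡ c → tri c at r ≡ true → ∃[ x ≤ n ] (suc (col x) ≡ c × row x ≡ r × QPred x)
    rtl {r = r} _ zero _ e = contradiction (zero-at r) (true≢false e)
    rtl {n} {a} {r} a≤n (suc c) ec e = x , ≤-trans (<⇒≤ (<-≤-trans (position-<col {a} r≤c (subst (c <_) (sym ec) ≤-refl)) (bot≤ a))) a≤n ,
        cong suc (proj₁ xpos) , proj₂ xpos ,
        from (Bit⇔at (tri (suc (col x))) (row x)) (subst₂ (λ c r → tri (suc c) at r ≡ true) (sym (proj₁ xpos)) (sym (proj₂ xpos)) e)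
      where
      r≤c : r ≤ c
      r≤c = ≤-pred (2^-cancel-< (≤-<-trans (at-true⇒≤ r e) (tri<2^ (suc c))))
      x : ℕ
      x = tri c + r
      xpos : col x ≡ c × row x ≡ r
      xpos = position-unique (refl , r≤c)

  -- `C` holds bits of column numbers, so the row of `a` is turned into a column: the diagonal
  -- element `e` of that row has it as its column number, and the column before `e` stores its bits.
  row-bitᵈ : (a d : Fin k) → DefB (λ n ρ → row (ρ ! a) at row (ρ ! d))
  row-bitᵈ a d = reformulate
    (∃ᵈ ∃ᵈ diagonalᵈ v1 ∧ᵈ row≡ᵈ v1 (s2 a) ∧ᵈ suc-colᵈ v0 v1 ∧ᵈ row≡ᵈ v0 (s2 d) ∧ᵈ atomᵈ cC (v0 ∷ []))
    λ {n} {ρ} B → mk⇔ (λ (e , _ , x , _ , dg , ea , ec , er , b) →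
        subst₂ (λ c r → c at r ≡ true) (trans ec (trans (sym dg) ea)) er (to (Bit⇔at (suc (col x)) (row x)) b))
      (rtl (B a) (row (ρ ! a)) refl)
    where
    rtl : ∀ {n a r} → a ≤ n → ∀ c → row a ≡ c → c at r ≡ true →
          ∃[ e ≤ n ] ∃[ x ≤ n ] (row e ≡ col e × row e ≡ c × suc (col x) ≡ col e × row x ≡ r × CPred x)
    rtl {r = r} _ zero _ e = contradiction (zero-at r) (true≢false e)
    rtl {n} {a} {r} a≤n (suc c) ea e = z , z≤ , x , ≤-trans (<⇒≤ (<-≤-trans (position-<col {z} r≤c (subst (c <_) (sym (proj₁ zpos)) ≤-refl)) (bot≤ z))) z≤ ,
        trans (proj₂ zpos) (sym (proj₁ zpos)) , proj₂ zpos , trans (cong suc (proj₁ xpos)) (sym (proj₁ zpos)) , proj₂ xpos ,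
        from (Bit⇔at (suc (col x)) (row x)) (subst₂ (λ c r → suc c at r ≡ true) (sym (proj₁ xpos)) (sym (proj₂ xpos)) e)
      where
      r≤c : r ≤ c
      r≤c = ≤-pred (at-true⇒< r e)
      x z : ℕ
      x = tri c + r
      z = tri (suc c) + suc c
      xpos : col x ≡ c × row x ≡ r
      xpos = position-unique (refl , r≤c)
      zpos : col z ≡ suc c × row z ≡ suc c
      zpos = position-unique (refl , ≤-refl)
      z≤ : z ≤ n
      z≤ = ≤-trans (position-≤ {a} (subst (_≤ col a) ea (row≤col a)) (≤-reflexive (sym ea))) a≤n

  carry-rowᵈ : (a d : Fin k) → DefB (λ n ρ → carry (tri (col (ρ ! a))) (row (ρ ! a)) (row (ρ ! d)))
  carry-rowᵈ a d = reformulate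
    (∃ᵈ row<ᵈ v0 (s1 d) ∧ᵈ (bot-bitᵈ (s1 a) v0 ∧ᵈ row-bitᵈ (s1 a) v0) ∧ᵈ
      (∀ᵈ row<ᵈ v1 v0 ⇒ᵈ row<ᵈ v0 (s2 d) ⇒ᵈ bot-bitᵈ (s2 a) v0 ∨ᵈ row-bitᵈ (s2 a) v0))
    λ {n} {ρ} B → ⇔-trans (rows (tri (col (ρ ! a))) (row (ρ ! a)) (B d)) (⇔-sym (carry⇔generated _ _ _))
    where
    rows : ∀ x y {n d} → d ≤ n → (∃[ j ≤ n ] (row j < row d × (x at row j ≡ true × y at row j ≡ true) ×
             (∀[ l ≤ n ] (row j < row l → row l < row d → x at row l ≡ true ⊎ y at row l ≡ true)))) ⇔
           (∃ λ j → Generated x y (row d) j)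
    rows x y {n} {d} d≤n = mk⇔
      (λ (j , _ , j< , g , p) → row j , j< , g , λ l j<l l<d →
        subst (λ l → x at l ≡ true ⊎ y at l ≡ true) (row-el l<d)
          (p (el l) (el≤ l<d) (subst (row j <_) (sym (row-el l<d)) j<l) (subst (_< row d) (sym (row-el l<d)) l<d)))
      (λ (j , j< , g , p) → el j , el≤ j< , subst (_< row d) (sym (row-el j<)) j< ,
        subst (λ j → x at j ≡ true × y at j ≡ true) (sym (row-el j<)) g ,
        λ l _ j<l l<d → p (row l) (subst (_< row l) (row-el j<) j<l) l<d)
      where
      el : ℕ → ℕ
      -- Column `row d` begins no later than the column of `d` and contains the rows 0 to `row d`,
      -- so every position up to `row d` has a representative not exceeding `d`.
      el j = tri (row d) + j
      row-el : ∀ {j} → j < row d → row (el j) ≡ j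
      row-el j< = proj₂ (position-unique (refl , <⇒≤ j<))
      el≤ : ∀ {j} → j < row d → el j ≤ n
      el≤ j< = ≤-trans (position-≤ {d} (row≤col d) (<⇒≤ j<)) d≤n

  at-rowᵈ : (a d : Fin k) → DefB (λ n ρ → (ρ ! a) at row (ρ ! d))
  at-rowᵈ a d = reformulate (xorᵇ (xorᵇ (bot-bitᵈ a d) (row-bitᵈ a d)) (carry-rowᵈ a d))
    λ {n} {ρ} _ → ≡⇒⇔ (cong (_≡ true) (trans (sym (at-+ (tri (col (ρ ! a))) (row (ρ ! a)) (row (ρ ! d))))
      (cong (_at row (ρ ! d)) (proj₁ (position (ρ ! a))))))

  tri+-≤ : ∀ k → tri (2 + k) + (2 + k) ≤ suc (2 ^ (2 + k))
  tri+-≤ zero = ≤-refl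
  tri+-≤ (suc k) = begin
    tri (3 + k) + (3 + k)                         ≡⟨ cong (_+ (3 + k)) (tri-suc (2 + k)) ⟩
    tri (2 + k) + (3 + k) + (3 + k)               ≡⟨ regroup′ (tri (2 + k)) k ⟩
    (tri (2 + k) + (2 + k)) + (4 + k)             ≤⟨ +-mono-≤ (tri+-≤ k) (step k) ⟩
    suc (2 ^ (2 + k)) + 2 ^ (2 + k)               ≡⟨ cong (suc (2 ^ (2 + k)) +_) (sym (+-identityʳ _)) ⟩
    suc (2 ^ (3 + k))                             ∎
    where
    open ≤-Reasoning
    regroup′ : ∀ t k → t + (3 + k) + (3 + k) ≡ (t + (2 + k)) + (4 + k)
    regroup′ = solve-∀
    step : ∀ k → 4 + k ≤ 2 ^ (2 + k)
    step zero = ≤-refl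
    step (suc k) = ≤-trans (s≤s (step k)) (^-monoʳ-< 2 ≤-refl (≤-refl {3 + k}))

  -- `tri k + k` is the least element of row `k`, so a number with bit `k` set that is less than `n`
  -- has this row available. The additional 1 comes from rows 2 and 3, which begin at 5 and 9.
  diagonal-≤ : ∀ k → tri k + k ≤ suc (2 ^ k)
  diagonal-≤ zero = z≤n
  diagonal-≤ (suc zero) = s≤s (s≤s z≤n)
  diagonal-≤ (suc (suc k)) = tri+-≤ k

  diagonal-≤2^ : ∀ k → tri (4 + k) + (4 + k) ≤ 2 ^ (4 + k)
  diagonal-≤2^ zero = m≤m+n 14 2
  diagonal-≤2^ (suc k) = begin
    tri (5 + k) + (5 + k)                 ≡⟨ cong (_+ (5 + k)) (tri-suc (4 + k)) ⟩
    tri (4 + k) + (5 + k) + (5 + k)       ≡⟨ regroup′ (tri (4 + k)) k ⟩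
    (tri (4 + k) + (4 + k)) + (6 + k)     ≤⟨ +-mono-≤ (diagonal-≤2^ k) (step k) ⟩
    2 ^ (4 + k) + 2 ^ (4 + k)             ≡⟨ cong (2 ^ (4 + k) +_) (sym (+-identityʳ _)) ⟩
    2 ^ (5 + k)                           ∎
    where
    open ≤-Reasoning
    regroup′ : ∀ t k → t + (5 + k) + (5 + k) ≡ (t + (4 + k)) + (6 + k)
    regroup′ = solve-∀
    step : ∀ k → 6 + k ≤ 2 ^ (4 + k)
    step zero = m≤m+n 6 10
    step (suc k) = ≤-trans (s≤s (step k)) (^-monoʳ-< 2 ≤-refl (≤-refl {5 + k}))

  row-diagonal : ∀ k → row (tri k + k) ≡ k
  row-diagonal k = proj₂ (position-unique (refl , ≤-refl))

  -- By i < d, every position of a bit of i has a row that meets [0,…,n].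
  row-numberᵈ : (d i : Fin k) → Def (λ n ρ → ρ ! i < ρ ! d × row (ρ ! d) ≡ ρ ! i)
  row-numberᵈ d i = reformulate (<ᵈ i d ∧ᵈ (∀ᵈ ≡ᵇ (row-bitᵈ (s1 d) v0) (at-rowᵈ (s1 i) v0)))
    λ {n} {ρ} B → mk⇔ (λ (i<d , same) → i<d , ltr (B d) i<d same)
                      (λ (i<d , e) → i<d , λ j _ → cong (_at row j) e)
    where
    ltr : ∀ {n i d} → d ≤ n → i < d → (∀[ j ≤ n ] (row d at row j ≡ i at row j)) → row d ≡ i
    ltr {n} {i} {d} d≤n i<d same = at-ext agree
      where
      row<d : row d < d
      row<d = ≤∧≢⇒< (≤-trans (row≤col d) (col≤ d)) λ e → n≮0 (subst (i <_) (col-zero (c0 e)) i<d)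
        where
        c0 : row d ≡ d → col d ≡ 0
        c0 e = n≤0⇒n≡0 (≤-trans (n≤tri (col d)) (≤-reflexive (+-cancelʳ-≡ (row d) (tri (col d)) 0 (trans (proj₁ (position d)) (sym e)))))
      at-k : ∀ {m} k → m < d → m at k ≡ true → row d at k ≡ i at k
      at-k k m<d e = subst (λ k → row d at k ≡ i at k) (row-diagonal k)
        (same (tri k + k) (≤-trans (diagonal-≤ k) (≤-trans (s≤s (at-true⇒≤ k e)) (≤-trans m<d d≤n))))
      agree : ∀ k → row d at k ≡ i at k
      agree k with row d at k ≟ᴮ i at k
      ... | yes e = e
      ... | no ne with differ⇒occurs k ne
      ...   | inj₁ e = at-k k row<d e
      ...   | inj₂ e = at-k k i<d e

  -- Row i meets [0,…,a] whenever bit i of a is set, except for (a,i) = (4,2) and (8,3).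
  BitFormula : ℕ → ℕ → ℕ → Set
  BitFormula n a i = (∃[ d ≤ n ] ((i < d × row d ≡ i) × a at row d ≡ true)) ⊎ (a ≡ 4 × i ≡ 2) ⊎ (a ≡ 8 × i ≡ 3)

  opaque
    unfolding _at_

    bit-exceptions : 4 at 2 ≡ true × 8 at 3 ≡ true
    bit-exceptions = refl , refl

  Bitᵈ : (a i : Fin k) → Def (λ n ρ → Bit (ρ ! a) (ρ ! i))
  Bitᵈ a i = reformulate
    ((∃ᵈ row-numberᵈ v0 (s1 i) ∧ᵈ at-rowᵈ (s1 a) v0) ∨ᵈ constᵈ 4 a ∧ᵈ constᵈ 2 i ∨ᵈ constᵈ 8 a ∧ᵈ constᵈ 3 i)
    λ {n} {ρ} B → ⇔-trans (mk⇔ ltr (λ e → rtl (B a) (ρ ! i) e (at-true⇒≤ (ρ ! i) e))) (⇔-sym (Bit⇔at (ρ ! a) (ρ ! i)))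
    where
    ltr : ∀ {n a i} → BitFormula n a i → a at i ≡ true
    ltr (inj₁ (_ , _ , (_ , refl) , e)) = e
    ltr (inj₂ (inj₁ (refl , refl))) = proj₁ bit-exceptions
    ltr (inj₂ (inj₂ (refl , refl))) = proj₂ bit-exceptions
    on-diagonal : ∀ {n a} i → a ≤ n → a at i ≡ true → tri i + i ≤ a → i < tri i + i → BitFormula n a i
    on-diagonal {a = a} i a≤n e d≤a i<d = inj₁ (tri i + i , ≤-trans d≤a a≤n , (i<d , row-diagonal i) ,
      subst (λ r → a at r ≡ true) (sym (row-diagonal i)) e)
    rtl : ∀ {n a} → a ≤ n → ∀ i → a at i ≡ true → 2 ^ i ≤ a → BitFormula n a i
    -- The diagonal element of row 0 is 0 itself, which is not above `i`; the element 1 represents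
    -- row 0 instead.
    rtl a≤n 0 e lo = inj₁ (1 , ≤-trans lo a≤n , (s≤s z≤n , refl) , e)
    rtl a≤n 1 e lo = on-diagonal 1 a≤n e lo ≤-refl
    rtl {a = a} a≤n 2 e lo with m≤n⇒m<n∨m≡n lo
    ... | inj₁ 5≤a = on-diagonal 2 a≤n e 5≤a (m≤m+n 3 2)
    ... | inj₂ 4≡a = inj₂ (inj₁ (sym 4≡a , refl))
    rtl a≤n 3 e lo with m≤n⇒m<n∨m≡n lo
    ... | inj₁ 9≤a = on-diagonal 3 a≤n e 9≤a (m≤m+n 4 5)
    ... | inj₂ 8≡a = inj₂ (inj₂ (sym 8≡a , refl))
    rtl a≤n i@(suc (suc (suc (suc k)))) e lo = on-diagonal i a≤n e (≤-trans (diagonal-≤2^ k) lo)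
      (m<n+m i (<-≤-trans (s≤s z≤n) (n≤tri i)))

  define-LBit : ∀ {j} (P : SymBit j) (xs : Vec (Fin k) j) → Def (λ n ρ → ⟦ P ⟧Bit (V.map (ρ !_) xs))
  define-LBit bit (a ∷ i ∷ []) = Bitᵈ a i

  LBit≼LSCQ : LBit ≼ LSCQ
  LBit≼LSCQ = Translation.≼-translate LBit LSCQ decLSCQ define-LBit

-- Arithmetic is definable from Bit

open BitOrder
open FO LBit decLBit
open OrderDefinability LBit decLBit <ᵈ

private
  variable
    k : ℕ

shr-shr : ∀ x a b → shr (shr x a) b ≡ shr x (a + b)
shr-shr x a b = at-ext λ i → trans (at-shr (shr x a) b i) (trans (at-shr x a (b + i))
  (trans (cong (x at_) (sym (+-assoc a b i))) (sym (at-shr x (a + b) i))))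

carryᵈ : (x y i : Fin k) → DefB (λ n ρ → carry (ρ ! x) (ρ ! y) (ρ ! i))
carryᵈ x y i = reformulate
  (∃ᵈ <ᵈ v0 (s1 i) ∧ᵈ (atᵈ (s1 x) v0 ∧ᵈ atᵈ (s1 y) v0) ∧ᵈ
    (∀ᵈ <ᵈ v1 v0 ⇒ᵈ <ᵈ v0 (s2 i) ⇒ᵈ atᵈ (s2 x) v0 ∨ᵈ atᵈ (s2 y) v0))
  λ {n} {ρ} B → ⇔-trans
    (mk⇔ (λ (j , _ , j< , g , f) → j , j< , g , λ l j<l l<i → f l (≤-trans (<⇒≤ l<i) (B i)) j<l l<i)
         (λ (j , j< , g , f) → j , ≤-trans (<⇒≤ j<) (B i) , j< , g , λ l _ → f l))
    (⇔-sym (carry⇔generated (ρ ! x) (ρ ! y) (ρ ! i)))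

≤⇒<2^ : ∀ {x n} → x ≤ n → x < 2 ^ n
≤⇒<2^ x≤n = ≤-<-trans x≤n (n<2^n _)

+ᵈ : (x y z : Fin k) → Def (λ n ρ → ρ ! x + ρ ! y ≡ ρ ! z)
+ᵈ x y z = reformulate
  (∀ᵈ ≡ᵇ (atᵈ (s1 z) v0) (xorᵇ (xorᵇ (atᵈ (s1 x) v0) (atᵈ (s1 y) v0)) (carryᵈ (s1 x) (s1 y) v0)))
  λ {n} {ρ} B → mk⇔
    -- The sum may exceed `n`, but it is below `2 ^ suc n`, so the positions 0 to `n` determine it.
    (λ f → at-ext< (suc n)
      (subst (ρ ! x + ρ ! y <_) (cong (2 ^ n +_) (sym (+-identityʳ _))) (+-mono-< (≤⇒<2^ (B x)) (≤⇒<2^ (B y))))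
      (<-≤-trans (≤⇒<2^ (B z)) (^-monoʳ-≤ 2 (n≤1+n n)))
      λ i i≤n → trans (at-+ (ρ ! x) (ρ ! y) i) (sym (f i (≤-pred i≤n))))
    (λ e i _ → trans (cong (_at i) (sym e)) (at-+ (ρ ! x) (ρ ! y) i))

true⇔-ext : ∀ {n a b} → a ≤ n → b ≤ n → (∀[ i ≤ n ] (a at i ≡ true ⇔ b at i ≡ true)) ⇔ (a ≡ b)
true⇔-ext {n} a≤n b≤n = mk⇔
  (λ f → at-ext< n (≤⇒<2^ a≤n) (≤⇒<2^ b≤n) λ i i<n → to ≡true (f i (<⇒≤ i<n)))
  (λ { refl i _ → ⇔-refl })

shrᵈ : (x j y : Fin k) → Def (λ n ρ → ρ ! y ≡ shr (ρ ! x) (ρ ! j))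
shrᵈ x j y = reformulate
  (∀ᵈ atᵈ (s1 y) v0 ⇔ᵈ (∃ᵈ +ᵈ (s2 j) v1 v0 ∧ᵈ atᵈ (s2 x) v0))
  λ {n} {ρ} B → ⇔-trans
    (mk⇔ (λ f i i≤n → ⇔-trans (f i i≤n) (bits (ρ ! x) (ρ ! j) (B x) i))
         (λ f i i≤n → ⇔-trans (f i i≤n) (⇔-sym (bits (ρ ! x) (ρ ! j) (B x) i))))
    (true⇔-ext (B y) (≤-trans (shr≤ (ρ ! x) (ρ ! j)) (B x)))
  where
  bits : ∀ {n} x j → x ≤ n → ∀ i → (∃[ s ≤ n ] (j + i ≡ s × x at s ≡ true)) ⇔ (shr x j at i ≡ true)
  bits x j x≤n i = ⇔-trans
    (mk⇔ (λ { (_ , _ , refl , e) → e }) (λ e → j + i , ≤-trans (<⇒≤ (at-true⇒< _ e)) x≤n , refl , e))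
    (≡⇒⇔ (cong (_≡ true) (sym (at-shr x j i))))

lowᵈ : (x j y : Fin k) → Def (λ n ρ → ρ ! y ≡ low (ρ ! x) (ρ ! j))
lowᵈ x j y = reformulate
  (∀ᵈ atᵈ (s1 y) v0 ⇔ᵈ (<ᵈ v0 (s1 j) ∧ᵈ atᵈ (s1 x) v0))
  λ {n} {ρ} B → ⇔-trans
    (mk⇔ (λ f i i≤n → ⇔-trans (f i i≤n) (bits (ρ ! x) (ρ ! j) i))
         (λ f i i≤n → ⇔-trans (f i i≤n) (⇔-sym (bits (ρ ! x) (ρ ! j) i))))
    (true⇔-ext (B y) (≤-trans (low≤ (ρ ! x) (ρ ! j)) (B x)))
  where
  bits : ∀ x j i → (i < j × x at i ≡ true) ⇔ (low x j at i ≡ true)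
  bits x j i = mk⇔ (λ (i<j , e) → trans (at-low x j i i<j) e) ltr
    where
    ltr : low x j at i ≡ true → i < j × x at i ≡ true
    ltr e with i <? j
    ... | yes i<j = i<j , trans (sym (at-low x j i i<j)) e
    ... | no i≮j = contradiction (at-low-≥ x j i (≮⇒≥ i≮j)) (true≢false e)

shr-low : ∀ {x j y} → (low y j ≡ 0 × x ≡ shr y j) ⇔ (y ≡ x * 2 ^ j)
shr-low {x} {j} {y} = mk⇔
  (λ { (e , refl) → trans (low+shr y j) (cong (_+ shr y j * 2 ^ j) e) })
  (λ { refl → low-unique j x (m^n>0 2 j) , sym (shr-unique j x (m^n>0 2 j)) })

low≡0ᵈ : (x j : Fin k) → Def (λ n ρ → low (ρ ! x) (ρ ! j) ≡ 0)
low≡0ᵈ x j = reformulate (∃ᵈ zeroᵈ v0 ∧ᵈ lowᵈ (s1 x) (s1 j) v0)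
  λ _ → mk⇔ (λ { (_ , _ , refl , e) → sym e }) (λ e → 0 , z≤n , refl , sym e)

shlᵈ : (x j y : Fin k) → Def (λ n ρ → ρ ! y ≡ ρ ! x * 2 ^ (ρ ! j))
shlᵈ x j y = reformulate (low≡0ᵈ y j ∧ᵈ shrᵈ y j x) λ _ → shr-low

shr≡0⇔<2^ : ∀ {x j} → (shr x j ≡ 0) ⇔ (x < 2 ^ j)
shr≡0⇔<2^ {x} {j} = mk⇔
  (λ e → subst (_< 2 ^ j) (sym (trans (low+shr x j) (trans (cong (λ s → low x j + s * 2 ^ j) e) (+-identityʳ _)))) (low< x j))
  (λ x< → trans (cong (λ x → shr x j) (sym (+-identityʳ x))) (shr-unique j 0 x<))

<2^ᵈ : (x j : Fin k) → Def (λ n ρ → ρ ! x < 2 ^ (ρ ! j))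
<2^ᵈ x j = reformulate (∃ᵈ zeroᵈ v0 ∧ᵈ shrᵈ (s1 x) (s1 j) v0)
  λ {n} {ρ} _ → ⇔-trans (mk⇔ (λ { (_ , _ , refl , e) → sym e }) (λ e → 0 , z≤n , refl , sym e)) (shr≡0⇔<2^ {ρ ! x} {ρ ! j})

segment : ℕ → ℕ → ℕ → ℕ
segment x p w = low (shr x p) w

segmentᵈ : (x p w y : Fin k) → Def (λ n ρ → ρ ! y ≡ segment (ρ ! x) (ρ ! p) (ρ ! w))
segmentᵈ x p w y = reformulate (∃ᵈ shrᵈ (s1 x) (s1 p) v0 ∧ᵈ lowᵈ v0 (s1 w) (s1 y))
  λ {n} {ρ} B → mk⇔ (λ { (_ , _ , refl , e) → e }) (λ e → _ , ≤-trans (shr≤ (ρ ! x) (ρ ! p)) (B x) , refl , e)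

segment≤ : ∀ x p w → segment x p w ≤ x
segment≤ x p w = ≤-trans (low≤ (shr x p) w) (shr≤ x p)

-- Divisibility and products of two digits

-- A set of multiples of g is recognised by being closed under subtraction of g down to 0.
Divides : ℕ → ℕ → ℕ → Set
Divides n g v = ∃[ S ≤ n ] (S at v ≡ true × (∀[ u ≤ n ] (S at u ≡ true →
  u ≡ 0 ⊎ (∃[ t ≤ n ] (S at t ≡ true × t + g ≡ u)))))

dividesᵈ : (g v : Fin k) → Def (λ n ρ → Divides n (ρ ! g) (ρ ! v))
dividesᵈ g v = ∃ᵈ atᵈ v0 (s1 v) ∧ᵈ (∀ᵈ atᵈ v1 v0 ⇒ᵈ
  zeroᵈ v0 ∨ᵈ (∃ᵈ atᵈ v2 v0 ∧ᵈ +ᵈ v0 (s3 g) v1))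

Divides⇒≤ : ∀ {n g v} → Divides n g v → v ≤ n
Divides⇒≤ (S , S≤n , v∈S , _) = ≤-trans (<⇒≤ (at-true⇒< _ v∈S)) S≤n

module _ {n g : ℕ} (0<g : 0 < g) where
  Divides⇒∣ : ∀ {v} → Divides n g v → g ∣ v
  Divides⇒∣ {v} (S , S≤n , v∈S , down) = go (suc v) ≤-refl v∈S
    where
    go : ∀ N {u} → u < N → S at u ≡ true → g ∣ u
    go (suc N) {u} u<N u∈S with down u (≤-trans (<⇒≤ (at-true⇒< u u∈S)) S≤n) u∈S
    ... | inj₁ refl = divides 0 refl
    ... | inj₂ (t , _ , t∈S , refl) = ∣m∣n⇒∣m+n (go N (<-≤-trans (m<m+n t 0<g) (≤-pred u<N)) t∈S) ∣-refl

  -- The set guessed for the larger multiple contains the smaller one, since it is closed under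
  -- subtracting `g`. In soundness proofs no size bound is at hand to build a new set, so the
  -- witness for the end of a run has to serve all earlier positions.
  Divides-≤ : ∀ {i j} → i ≤ j → Divides n g (j * g) → Divides n g (i * g)
  Divides-≤ {i} {j} i≤j (S , S≤n , j∈S , down) with m≤n⇒∃[o]m+o≡n i≤j
  ... | d , refl = S , S≤n , go d (subst (λ e → S at (e * g) ≡ true) (+-comm i d) j∈S) , down
    where
    go : ∀ d → S at ((d + i) * g) ≡ true → S at (i * g) ≡ true
    go zero e = e
    go (suc d) e with down ((suc d + i) * g) (≤-trans (<⇒≤ (at-true⇒< _ e)) S≤n) e
    ... | inj₁ z = contradiction (subst (0 <_) z (<-≤-trans 0<g (m≤m+n g _))) (<-irrefl refl)
    ... | inj₂ (t , _ , t∈S , eq) =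
      go d (subst (λ x → S at x ≡ true) (+-cancelʳ-≡ g t _ (trans eq (+-comm g _))) t∈S)

  ∣⇒Divides : ∀ {v} → g ∣ v → 2 ^ suc v ≤ n → Divides n g v
  ∣⇒Divides {v} g∣v fits = set , ≤-trans (<⇒≤ set<) fits , from ∈set (≤-refl , g∣v) , λ u _ → down u
    where
    open Comprehension (g ∣?_) (suc v)
    down : ∀ u → set at u ≡ true → u ≡ 0 ⊎ (∃[ t ≤ n ] (set at t ≡ true × t + g ≡ u))
    down u u∈ with to ∈set u∈
    ... | u≤v , divides-refl zero = inj₁ refl
    ... | u≤v , divides-refl (suc q) = inj₂ (q * g , ≤-trans (<⇒≤ (at-true⇒< _ t∈)) (≤-trans (<⇒≤ set<) fits) , t∈ , +-comm (q * g) g)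
      where
      t∈ : set at (q * g) ≡ true
      t∈ = from ∈set (≤-trans (s≤s (m≤n+m (q * g) g)) u≤v , divides-refl q)

-- For d < 2^h and t ≤ e 2^h:  t = d e  iff  1 + e 2^h divides d + t 2^h, the cofactor then being d itself.
SmallProduct : ℕ → ℕ → ℕ → ℕ → ℕ → Set
SmallProduct n d e h t = ∃[ e′ ≤ n ] ∃[ g ≤ n ] ∃[ t′ ≤ n ] ∃[ v ≤ n ]
  (e′ ≡ e * 2 ^ h × suc e′ ≡ g × t′ ≡ t * 2 ^ h × d + t′ ≡ v × t ≤ e′ × d < 2 ^ h × Divides n g v)

smallProductᵈ : (d e h t : Fin k) → Def (λ n ρ → SmallProduct n (ρ ! d) (ρ ! e) (ρ ! h) (ρ ! t))
smallProductᵈ d e h t = ∃ᵈ ∃ᵈ ∃ᵈ ∃ᵈ shlᵈ (s4 e) (s4 h) v3 ∧ᵈ sucᵈ v3 v2 ∧ᵈ shlᵈ (s4 t) (s4 h) v1 ∧ᵈ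
  +ᵈ (s4 d) v1 v0 ∧ᵈ ≤ᵈ (s4 t) v3 ∧ᵈ <2^ᵈ (s4 d) (s4 h) ∧ᵈ dividesᵈ v2 v0

-- If the cofactor `i` were at least `H`, the right side of `eq′` would exceed the left, by `d < H`
-- and `t ≤ e * H`. With `i < H`, both sides are written in base `H`: the lowest digits give
-- `d ≡ i`, the remaining parts `t ≡ i * e`.
smallProduct-sound : ∀ {n d e h t} → SmallProduct n d e h t → t ≡ d * e
smallProduct-sound {n} {d} {e} {h} {t} (_ , _ , _ , _ , _ , _ , _ , _ , refl , refl , refl , refl , t≤ , d< , div)
  with Divides⇒∣ (s≤s z≤n) div
... | divides i eq = trans (sym (shr-unique h t d<)) (trans (cong (λ x → shr x h) eq′)
        (trans (shr-unique h (i * e) i<) (cong (_* e) (sym d≡i))))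
  where
  H = 2 ^ h
  expand : ∀ i e H → i * suc (e * H) ≡ i + i * e * H
  expand = solve-∀
  eq′ : d + t * H ≡ i + i * e * H
  eq′ = trans eq (expand i e H)
  i< : i < H
  i< = ≰⇒> λ H≤i → <⇒≱ (begin-strict
    d + t * H         <⟨ +-mono-<-≤ d< (*-monoˡ-≤ H t≤) ⟩
    H + e * H * H     ≡⟨ cong (λ x → H + x * H) (*-comm e H) ⟩
    H + H * e * H     ∎) (begin
    H + H * e * H     ≤⟨ +-mono-≤ H≤i (*-monoˡ-≤ H (*-monoˡ-≤ e H≤i)) ⟩
    i + i * e * H     ≡⟨ sym eq′ ⟩
    d + t * H         ∎)
    where open ≤-Reasoning
  d≡i : d ≡ i
  d≡i = trans (sym (low-unique h t d<)) (trans (cong (λ x → low x h) eq′) (low-unique h (i * e) i<))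

-- The largest multiple is `v = d * suc (e * H)`, at most `H * (H * H)`. Its set of smaller
-- multiples needs one bit per number up to `v`, which explains the double exponential and the
-- exponent `h + (h + h)`.
smallProduct-complete : ∀ {n d e h} → d < 2 ^ h → e < 2 ^ h → 2 ^ suc (2 ^ (h + (h + h))) ≤ n → SmallProduct n d e h (d * e)
smallProduct-complete {n} {d} {e} {h} d< e< fits =
  e * H , ≤-trans (≤-trans (n≤1+n _) g≤) cube≤ , suc (e * H) , ≤-trans g≤ cube≤ ,
  d * e * H , ≤-trans (m≤n+m _ d) (≤-trans v≤ cube≤) , d + d * e * H , ≤-trans v≤ cube≤ ,
  refl , refl , refl , refl , ≤-trans (≤-reflexive (*-comm d e)) (*-monoʳ-≤ e (<⇒≤ d<)) , d< ,
  ∣⇒Divides (s≤s z≤n) (divides d (sym (expand d e H))) (≤-trans (^-monoʳ-≤ 2 (s≤s v≤)) fits)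
  where
  H = 2 ^ h
  expand : ∀ i e H → i * suc (e * H) ≡ i + i * e * H
  expand = solve-∀
  cube : 2 ^ (h + (h + h)) ≡ H * (H * H)
  cube = trans (^-distribˡ-+-* 2 h (h + h)) (cong (H *_) (^-distribˡ-+-* 2 h h))
  0<H : 0 < H
  0<H = m^n>0 2 h
  g≤H² : suc (e * H) ≤ H * H
  g≤H² = ≤-trans (+-monoˡ-≤ (e * H) 0<H) (*-monoˡ-≤ H e<)
  v≤ : d + d * e * H ≤ 2 ^ (h + (h + h))
  v≤ = subst₂ _≤_ (expand d e H) (sym cube) (*-mono-≤ (<⇒≤ d<) g≤H²)
  g≤ : suc (e * H) ≤ 2 ^ (h + (h + h))
  g≤ = subst (suc (e * H) ≤_) (sym cube) (≤-trans g≤H² (≤-trans (≤-reflexive (sym (*-identityˡ _))) (*-monoˡ-≤ (H * H) 0<H)))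
  cube≤ : 2 ^ (h + (h + h)) ≤ n
  cube≤ = ≤-trans (<⇒≤ (n<2^n C)) (≤-trans (^-monoʳ-≤ 2 (n≤1+n C)) fits)
    where C = 2 ^ (h + (h + h))

-- Coded sequences and runs

encode : (ℕ → ℕ) → ℕ → ℕ → ℕ
encode f w zero = 0
encode f w (suc k) = f 0 + encode (λ u → f (suc u)) w k * 2 ^ w

encode< : ∀ f w k → (∀ u → u < k → f u < 2 ^ w) → encode f w k < 2 ^ (k * w)
encode< f w zero f< = s≤s z≤n
encode< f w (suc k) f< = begin-strict
  f 0 + N * 2 ^ w       <⟨ +-monoˡ-< (N * 2 ^ w) (f< 0 (s≤s z≤n)) ⟩
  suc N * 2 ^ w         ≤⟨ *-monoˡ-≤ (2 ^ w) (encode< (λ u → f (suc u)) w k λ u u<k → f< (suc u) (s≤s u<k)) ⟩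
  2 ^ (k * w) * 2 ^ w   ≡⟨ trans (sym (^-distribˡ-+-* 2 (k * w) w)) (cong (2 ^_) (+-comm (k * w) w)) ⟩
  2 ^ (suc k * w)       ∎
  where
  open ≤-Reasoning
  N = encode (λ u → f (suc u)) w k

segment-encode : ∀ f w k → (∀ u → u < k → f u < 2 ^ w) → ∀ {u} → u < k → segment (encode f w k) (u * w) w ≡ f u
segment-encode f w (suc k) f< {zero} u< = trans (cong (λ x → low x w) (shr-zero _))
  (low-unique w (encode (λ u → f (suc u)) w k) (f< 0 (s≤s z≤n)))
segment-encode f w (suc k) f< {suc u} (s≤s u<) = trans
  (cong (λ x → low x w) (trans (sym (shr-shr _ w (u * w)))
    (cong (λ x → shr x (u * w)) (shr-unique w (encode (λ u → f (suc u)) w k) (f< 0 (s≤s z≤n))))))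
  (segment-encode (λ u → f (suc u)) w k (λ u u< → f< (suc u) (s≤s u<)) u<)

-- Multiplication is not yet available, but a factor that is a power of two takes only doublings;
-- hence cells are 8 digits wide.
octupleᵈ : (p q : Fin k) → Def (λ n ρ → 8 * ρ ! p ≡ ρ ! q)
octupleᵈ p q = reformulate (∃ᵈ ∃ᵈ +ᵈ (s2 p) (s2 p) v1 ∧ᵈ +ᵈ v1 v1 v0 ∧ᵈ +ᵈ v0 v0 (s2 q))
  λ {n} {ρ} B → mk⇔ (λ { (_ , _ , _ , _ , refl , refl , e) → trans (eight (ρ ! p)) e })
    (λ e → let e′ = trans (sym (eight (ρ ! p))) e
               4≤ = ≤-trans (m≤m+n _ _) (≤-trans (≤-reflexive e′) (B q)) in
      _ , ≤-trans (m≤m+n _ _) 4≤ , _ , 4≤ , refl , refl , e′)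
  where
  eight : ∀ p → 8 * p ≡ ((p + p) + (p + p)) + ((p + p) + (p + p))
  eight = solve-∀

-- The states of a run with steps of size w are coded by E in cells of width 8w: the state at p = uw is at 8p.
Cell : ℕ → ℕ → ℕ → ℕ → ℕ → Set
Cell n E w p a = 8 * p ≤ n × 8 * w ≤ n × a ≡ segment E (8 * p) (8 * w)

cellᵈ : (E w p a : Fin k) → Def (λ n ρ → Cell n (ρ ! E) (ρ ! w) (ρ ! p) (ρ ! a))
cellᵈ E w p a = reformulate
  (∃ᵈ ∃ᵈ octupleᵈ (s2 p) v1 ∧ᵈ octupleᵈ (s2 w) v0 ∧ᵈ segmentᵈ (s2 E) v1 v0 (s2 a))
  λ _ → mk⇔ (λ { (_ , p≤ , _ , w≤ , refl , refl , e) → p≤ , w≤ , e })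
            (λ (p≤ , w≤ , e) → _ , p≤ , _ , w≤ , refl , refl , e)

-- A whole computation is guessed as `E` and checked step by step, from state 0 at position 0 to
-- state `s` at `P`. Steps are indexed by the positions `u * w` rather than by `u`, since passing
-- from `u` to `u * w` would be a multiplication.
Run₅ : ℕ → ℕ → (ℕ → ℕ → ℕ → ℕ → ℕ → Set) → ℕ → ℕ → Set
Run₅ n w St P s = Divides n w P × (∃[ E ≤ n ] ((∃[ o ≤ n ] (o ≡ 0 × Cell n E w o o)) × Cell n E w P s ×
  (∀[ p ≤ n ] (p < P → Divides n w p →
    ∃[ q ≤ n ] ∃[ a ≤ n ] ∃[ b ≤ n ] (p + w ≡ q × Cell n E w p a × Cell n E w q b × St E p q a b)))))

runᵈ : {St : ℕ → Vec ℕ (5 + k) → Set} (w P s : Fin k) → Def St →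
       Def (λ n ρ → Run₅ n (ρ ! w) (λ E p q a b → St n (b ∷ a ∷ q ∷ p ∷ E ∷ ρ)) (ρ ! P) (ρ ! s))
runᵈ w P s Stᵈ = dividesᵈ w P ∧ᵈ (∃ᵈ (∃ᵈ zeroᵈ v0 ∧ᵈ cellᵈ v1 (s2 w) v0 v0) ∧ᵈ cellᵈ v0 (s1 w) (s1 P) (s1 s) ∧ᵈ
  (∀ᵈ <ᵈ v0 (s2 P) ⇒ᵈ dividesᵈ (s2 w) v0 ⇒ᵈ
    (∃ᵈ ∃ᵈ ∃ᵈ +ᵈ v3 (s5 w) v2 ∧ᵈ cellᵈ v4 (s5 w) v3 v1 ∧ᵈ cellᵈ v4 (s5 w) v2 v0 ∧ᵈ Stᵈ)))

Run : ℕ → ℕ → (ℕ → ℕ → ℕ → Set) → ℕ → ℕ → Set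
Run n w St = Run₅ n w (λ E p q a b → St p a b)

module _ {n w : ℕ} {St : ℕ → ℕ → ℕ → Set} (0<w : 0 < w) where

  run-invariant : (Inv : ℕ → ℕ → Set) → Inv 0 0 → ∀ k →
    (∀ u {a b} → u < k → Divides n w (u * w) → Inv u a → St (u * w) a b → Inv (suc u) b) →
    ∀ {s} → Run n w St (k * w) s → Inv k s
  run-invariant Inv base k step {s} (div , E , _ , (_ , _ , refl , _ , _ , init) , (_ , _ , final) , steps) =
    subst (Inv k) (sym final) (go k ≤-refl)
    where
    state : ℕ → ℕ
    state u = segment E (8 * (u * w)) (8 * w)
    go : ∀ u → u ≤ k → Inv u (state u)
    go zero _ = subst (Inv 0) init base
    go (suc u) u<k with steps (u * w) (Divides⇒≤ divᵤ) (*-monoˡ-< w {{>-nonZero 0<w}} u<k) divᵤ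
      where
      divᵤ : Divides n w (u * w)
      divᵤ = Divides-≤ 0<w (<⇒≤ u<k) div
    ... | _ , _ , a , _ , b , _ , refl , (_ , _ , refl) , (_ , _ , eb) , st =
      subst (Inv (suc u)) (trans eb (cong (λ p → segment E (8 * p) (8 * w)) (+-comm (u * w) w)))
        (step u u<k (Divides-≤ 0<w (<⇒≤ u<k) div) (go u (<⇒≤ u<k)) st)

  run-complete : (f : ℕ → ℕ) → f 0 ≡ 0 → ∀ k → (∀ u → u ≤ k → f u < 2 ^ (8 * w)) →
    (∀ u → u < k → St (u * w) (f u) (f (suc u))) →
    2 ^ (suc k * (8 * w)) ≤ n → Run n w St (k * w) (f k)
  run-complete f f0 k f< step fits = ∣⇒Divides 0<w (divides k refl) (≤-trans (^-monoʳ-≤ 2 kw<) fits) ,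
    E , E≤ , (0 , z≤n , refl , z≤n , w≤ , trans (sym f0) (sym (state {0} z≤n))) , cell k ≤-refl , steps
    where
    E : ℕ
    E = encode f (8 * w) (suc k)
    E≤ : E ≤ n
    E≤ = ≤-trans (<⇒≤ (encode< f (8 * w) (suc k) (λ u u< → f< u (≤-pred u<)))) fits
    state : ∀ {u} → u ≤ k → segment E (8 * (u * w)) (8 * w) ≡ f u
    state {u} u≤k = trans (cong (λ p → segment E p (8 * w)) (assoc u w))
      (segment-encode f (8 * w) (suc k) (λ u u< → f< u (≤-pred u<)) (s≤s u≤k))
      where
      assoc : ∀ u w → 8 * (u * w) ≡ u * (8 * w)
      assoc = solve-∀
    width≤ : suc k * (8 * w) ≤ n
    width≤ = ≤-trans (<⇒≤ (n<2^n _)) fits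
    8p≤ : ∀ {u} → u ≤ k → 8 * (u * w) ≤ n
    8p≤ {u} u≤k = ≤-trans (*-monoʳ-≤ 8 (*-monoˡ-≤ w u≤k)) (≤-trans (≤-trans (≤-reflexive (assoc k w)) (m≤n+m _ (8 * w))) width≤)
      where
      assoc : ∀ u w → 8 * (u * w) ≡ u * (8 * w)
      assoc = solve-∀
    p≤ : ∀ {u} → u ≤ k → u * w ≤ n
    p≤ u≤k = ≤-trans (m≤m+n _ _) (8p≤ u≤k)
    w≤ : 8 * w ≤ n
    w≤ = ≤-trans (m≤m+n (8 * w) _) width≤
    kw< : suc (k * w) ≤ suc k * (8 * w)
    kw< = +-mono-≤ (≤-trans 0<w (m≤m+n w _)) (*-monoʳ-≤ k (m≤m+n w _))
    cell : ∀ u → u ≤ k → Cell n E w (u * w) (f u)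
    cell u u≤k = 8p≤ u≤k , w≤ , sym (state u≤k)
    f≤ : ∀ u → u ≤ k → f u ≤ n
    f≤ u u≤k = ≤-trans (≤-reflexive (sym (state u≤k))) (≤-trans (segment≤ E (8 * (u * w)) (8 * w)) E≤)
    steps : ∀[ p ≤ n ] (p < k * w → Divides n w p →
      ∃[ q ≤ n ] ∃[ a ≤ n ] ∃[ b ≤ n ] (p + w ≡ q × Cell n E w p a × Cell n E w q b × St p a b))
    steps p _ p<P div with Divides⇒∣ 0<w div
    ... | divides-refl u = suc u * w , p≤ u<k , f u , f≤ u (<⇒≤ u<k) , f (suc u) , f≤ (suc u) u<k ,
        +-comm (u * w) w , cell u (<⇒≤ u<k) , cell (suc u) u<k , step u u<k
      where
      u<k : u < k
      u<k = *-cancelʳ-< w u k p<P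

-- Digit expansions and convolution

encode-cong : ∀ {f g} w k → (∀ u → f u ≡ g u) → encode f w k ≡ encode g w k
encode-cong w zero e = refl
encode-cong w (suc k) e = cong₂ (λ a N → a + N * 2 ^ w) (e 0) (encode-cong w k λ u → e (suc u))

encode-zero : ∀ {f} w k → (∀ u → f u ≡ 0) → encode f w k ≡ 0
encode-zero w zero e = refl
encode-zero w (suc k) e = cong₂ (λ a N → a + N * 2 ^ w) (e 0) (encode-zero w k λ u → e (suc u))

encode-support : ∀ {f} w {k N} → k ≤ N → (∀ u → k ≤ u → f u ≡ 0) → encode f w N ≡ encode f w k
encode-support {f} w {N = N} z≤n f0 = encode-zero w N λ u → f0 u z≤n
encode-support {f} w (s≤s k≤N) f0 = cong (λ N → f 0 + N * 2 ^ w) (encode-support w k≤N λ u k≤u → f0 (suc u) (s≤s k≤u))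

encode-linear : ∀ c f g w k → encode (λ u → c * f u + g u) w k ≡ c * encode f w k + encode g w k
encode-linear c f g w zero = sym (trans (+-identityʳ (c * 0)) (*-zeroʳ c))
encode-linear c f g w (suc k) = trans
  (cong (λ N → c * f 0 + g 0 + N * 2 ^ w) (encode-linear c (λ u → f (suc u)) (λ u → g (suc u)) w k))
  (distribute c (f 0) (g 0) (encode (λ u → f (suc u)) w k) (encode (λ u → g (suc u)) w k) (2 ^ w))
  where
  distribute : ∀ c a b F G B → (c * a + b) + (c * F + G) * B ≡ c * (a + F * B) + (b + G * B)
  distribute = solve-∀

encode-snoc : ∀ f w k → encode f w (suc k) ≡ encode f w k + f k * 2 ^ (k * w)
encode-snoc f w zero = trans (+-identityʳ (f 0)) (sym (*-identityʳ (f 0)))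
encode-snoc f w (suc k) = trans
  (cong (λ N → f 0 + N * 2 ^ w) (encode-snoc (λ u → f (suc u)) w k))
  (trans (regroup′ (f 0) (encode (λ u → f (suc u)) w k) (f (suc k)) (2 ^ (k * w)) (2 ^ w))
    (cong (λ p → encode f w (suc k) + f (suc k) * p) (sym (^-distribˡ-+-* 2 w (k * w)))))
  where
  regroup′ : ∀ a N b p B → a + (N + b * p) * B ≡ (a + N * B) + b * (B * p)
  regroup′ = solve-∀

encode-digits : ∀ x w k → x < 2 ^ (k * w) → encode (λ u → segment x (u * w) w) w k ≡ x
encode-digits x w zero (s≤s z≤n) = refl
encode-digits x w (suc k) x< = trans
  (cong₂ (λ a N → a + N * 2 ^ w) (cong (λ y → low y w) (shr-zero x))
    (trans (encode-cong w k λ u → cong (λ y → low y w) (sym (shr-shr x w (u * w))))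
      (encode-digits (shr x w) w k shr<)))
  (sym (low+shr x w))
  where
  shr< : shr x w < 2 ^ (k * w)
  shr< = *-cancelʳ-< (2 ^ w) _ _ (≤-<-trans (≤-trans (m≤n+m _ (low x w)) (≤-reflexive (sym (low+shr x w))))
    (subst (x <_) (trans (^-distribˡ-+-* 2 w (k * w)) (*-comm (2 ^ w) _)) x<))

partialConv : (ℕ → ℕ) → (ℕ → ℕ) → ℕ → ℕ → ℕ
partialConv f g k zero = 0
partialConv f g k (suc u) = partialConv f g k u + f u * g (k ∸ u)

convolution : (ℕ → ℕ) → (ℕ → ℕ) → ℕ → ℕ
convolution f g k = partialConv f g k (suc k)

partialConv-suc : ∀ f g k u → partialConv f g (suc k) (suc u) ≡ f 0 * g (suc k) + partialConv (λ v → f (suc v)) g k u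
partialConv-suc f g k zero = sym (+-identityʳ _)
partialConv-suc f g k (suc u) = trans (cong (_+ f (suc u) * g (k ∸ u)) (partialConv-suc f g k u))
  (+-assoc (f 0 * g (suc k)) _ _)

partialConv-zero : ∀ {f} g k u → (∀ v → f v ≡ 0) → partialConv f g k u ≡ 0
partialConv-zero g k zero f0 = refl
partialConv-zero g k (suc u) f0 = cong₂ _+_ (partialConv-zero g k u f0) (cong (_* g (k ∸ u)) (f0 u))

-- Multiplication of polynomials evaluated at `2 ^ w`: column sums exceed the base, so `encode` is
-- here a Horner sum and not a digit expansion. The induction splits off the lowest coefficient of
-- `f`; `K + M ≤ N` makes sure that no column is cut off.
encode-convolution : ∀ f g w K {M N} → K + M ≤ N → (∀ u → K ≤ u → f u ≡ 0) → (∀ u → M ≤ u → g u ≡ 0) →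
  encode (convolution f g) w N ≡ encode f w K * encode g w M
encode-convolution f g w zero {N = N} _ f0 g0 = encode-zero w N λ k → partialConv-zero g k (suc k) λ u → f0 u z≤n
encode-convolution f g w (suc K) {M} {suc N} (s≤s K+M≤N) f0 g0 = begin
  f 0 * g 0 + encode (λ k → convolution f g (suc k)) w N * B
    ≡⟨ cong (λ e → f 0 * g 0 + e * B) (trans (encode-cong w N λ k → partialConv-suc f g k (suc k))
         (encode-linear (f 0) (λ k → g (suc k)) (convolution f′ g) w N)) ⟩
  f 0 * g 0 + (f 0 * encode (λ k → g (suc k)) w N + encode (convolution f′ g) w N) * B
    ≡⟨ distribute (f 0) (g 0) (encode (λ k → g (suc k)) w N) (encode (convolution f′ g) w N) B ⟩
  f 0 * encode g w (suc N) + encode (convolution f′ g) w N * B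
    ≡⟨ cong₂ (λ a b → f 0 * a + b * B) (encode-support w (≤-trans (m≤n+m M K) (≤-trans K+M≤N (n≤1+n N))) g0)
         (encode-convolution f′ g w K K+M≤N (λ u K≤u → f0 (suc u) (s≤s K≤u)) g0) ⟩
  f 0 * encode g w M + encode f′ w K * encode g w M * B
    ≡⟨ collect (f 0) (encode f′ w K) (encode g w M) B ⟩
  (f 0 + encode f′ w K * B) * encode g w M ∎
  where
  open ≡-Reasoning
  f′ : ℕ → ℕ
  f′ u = f (suc u)
  B : ℕ
  B = 2 ^ w
  distribute : ∀ a b G C B → a * b + (a * G + C) * B ≡ a * (b + G * B) + C * B
  distribute = solve-∀
  collect : ∀ a F G B → a * G + F * G * B ≡ (a + F * B) * G
  collect = solve-∀

digit : ℕ → ℕ → ℕ → ℕ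
digit w x u = segment x (u * w) w

digit-zero : ∀ w K {x} → x < 2 ^ (K * w) → ∀ u → K ≤ u → digit w x u ≡ 0
digit-zero w K {x} x< u K≤u = trans (cong (λ y → low y w) (from (shr≡0⇔<2^ {x} {u * w}) (<-≤-trans x< (^-monoʳ-≤ 2 (*-monoˡ-≤ w K≤u)))))
  (n≤0⇒n≡0 (low≤ 0 w))

product-digits : ∀ w K {x y} → x < 2 ^ (K * w) → y < 2 ^ (K * w) →
  encode (convolution (digit w x) (digit w y)) w (K + K) ≡ x * y
product-digits w K {x} {y} x< y< = trans
  (encode-convolution (digit w x) (digit w y) w K ≤-refl (digit-zero w K x<) (digit-zero w K y<))
  (cong₂ _*_ (encode-digits x w K x<) (encode-digits y w K y<))

-- Multiplication column by column

ConvStep : ℕ → ℕ → ℕ → ℕ → ℕ → ℕ → ℕ → ℕ → Set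
ConvStep n w x y q p a b = ∃[ r ≤ n ] ∃[ d ≤ n ] ∃[ e ≤ n ] ∃[ t ≤ n ]
  (p + r ≡ q × d ≡ segment x p w × e ≡ segment y r w × SmallProduct n d e w t × a + t ≡ b)

-- Column k has k + 1 terms, so its run ends one step after `q`.
Conv : ℕ → ℕ → ℕ → ℕ → ℕ → ℕ → Set
Conv n w x y q s = ∃[ q′ ≤ n ] (q + w ≡ q′ × Run n w (ConvStep n w x y q) q′ s)

-- Schoolbook multiplication: the carry `r` plus the column sum `s` is the digit of `z` plus `2 ^ w`
-- times the next carry `r′`. The history certifying `s` is guessed anew in each step, so the
-- quadratically many partial sums are never stored together.
MulStep : ℕ → ℕ → ℕ → ℕ → ℕ → ℕ → ℕ → ℕ → Set
MulStep n w x y z q r r′ = ∃[ s ≤ n ] ∃[ c ≤ n ] ∃[ d ≤ n ] ∃[ u ≤ n ]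
  (Conv n w x y q s × d ≡ segment z q w × c ≡ r′ * 2 ^ w × d + c ≡ u × r + s ≡ u)

-- The digit width is guessed, not defined from `n`: whichever positive `w` passes the tests, `z` is
-- the product. Its size matters only for the existence of the guesses. The final carry 0 says that
-- `z` has no further digits.
DigitProduct : ℕ → ℕ → ℕ → ℕ → Set
DigitProduct n x y z = ∃[ w ≤ n ] ∃[ P ≤ n ] ∃[ Q ≤ n ] ∃[ o ≤ n ]
  (o ≡ 0 × o < w × Divides n w P × P + P ≡ Q × x < 2 ^ P × y < 2 ^ P × z < 2 ^ Q × Run n w (MulStep n w x y z) Q o)

convᵈ : (w x y q s : Fin k) → Def (λ n ρ → Conv n (ρ ! w) (ρ ! x) (ρ ! y) (ρ ! q) (ρ ! s))
convᵈ w x y q s = ∃ᵈ +ᵈ (s1 q) (s1 w) v0 ∧ᵈ runᵈ (s1 w) v0 (s1 s)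
  -- The shifts pass the four variables of the step, the five of `runᵈ` (`E`, `p`, `q`, `a`, `b`,
  -- from `v4` down to `v0`), and `q′`.
  (∃ᵈ ∃ᵈ ∃ᵈ ∃ᵈ +ᵈ (s4 v3) v3 (s4 (s5 (s1 q))) ∧ᵈ
    segmentᵈ (s4 (s5 (s1 x))) (s4 v3) (s4 (s5 (s1 w))) v2 ∧ᵈ
    segmentᵈ (s4 (s5 (s1 y))) v3 (s4 (s5 (s1 w))) v1 ∧ᵈ
    smallProductᵈ v2 v1 (s4 (s5 (s1 w))) v0 ∧ᵈ +ᵈ (s4 v1) v0 (s4 v0))

digitProductᵈ : (x y z : Fin k) → Def (λ n ρ → DigitProduct n (ρ ! x) (ρ ! y) (ρ ! z))
digitProductᵈ x y z = ∃ᵈ ∃ᵈ ∃ᵈ ∃ᵈ zeroᵈ v0 ∧ᵈ <ᵈ v0 v3 ∧ᵈ dividesᵈ v3 v2 ∧ᵈ +ᵈ v2 v2 v1 ∧ᵈ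
  <2^ᵈ (s4 x) v2 ∧ᵈ <2^ᵈ (s4 y) v2 ∧ᵈ <2^ᵈ (s4 z) v1 ∧ᵈ runᵈ v3 v1 v0
    (∃ᵈ ∃ᵈ ∃ᵈ ∃ᵈ convᵈ (s4 (s5 v3)) (s4 (s5 (s4 x))) (s4 (s5 (s4 y))) (s4 v3) v3 ∧ᵈ
      segmentᵈ (s4 (s5 (s4 z))) (s4 v3) (s4 (s5 v3)) v1 ∧ᵈ
      shlᵈ (s4 v0) (s4 (s5 v3)) v2 ∧ᵈ +ᵈ v1 v2 v0 ∧ᵈ +ᵈ (s4 v1) v3 v0)

∸-complement : ∀ {u w r} k → 0 < w → u ≤ k → u * w + r ≡ k * w → r ≡ (k ∸ u) * w
∸-complement {u} {w} {r} k 0<w u≤k e = +-cancelˡ-≡ (u * w) r _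
  (trans e (trans (cong (_* w) (sym (m+[n∸m]≡n u≤k))) (*-distribʳ-+ w u (k ∸ u))))

conv-sound : ∀ {n w x y} k {s} → 0 < w → Conv n w x y (k * w) s → s ≡ convolution (digit w x) (digit w y) k
conv-sound {n} {w} {x} {y} k {s} 0<w (_ , _ , refl , run) =
  run-invariant 0<w (λ u a → a ≡ partialConv X Y k u) refl (suc k) step
    (subst (λ P → Run n w (ConvStep n w x y (k * w)) P s) (+-comm (k * w) w) run)
  where
  X = digit w x
  Y = digit w y
  step : ∀ u {a b} → u < suc k → Divides n w (u * w) → a ≡ partialConv X Y k u →
         ConvStep n w x y (k * w) (u * w) a b → b ≡ partialConv X Y k (suc u)
  step u {a} {b} u≤k _ e (r , _ , d , _ , d′ , _ , t , _ , er , ed , ed′ , sp , eb) =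
    trans (sym eb) (cong₂ _+_ e (trans (smallProduct-sound {h = w} sp) (cong₂ _*_ ed
      (trans ed′ (cong (λ r → segment y r w) (∸-complement k 0<w (≤-pred u≤k) er))))))

low-+ : ∀ z a b → low z (a + b) ≡ low z a + segment z a b * 2 ^ a
low-+ z a b = trans (cong (λ x → low x (a + b)) split) (low-unique (a + b) (shr (shr z a) b) small)
  where
  split : z ≡ (low z a + segment z a b * 2 ^ a) + shr (shr z a) b * 2 ^ (a + b)
  split = trans (low+shr z a) (trans (cong (λ x → low z a + x * 2 ^ a) (low+shr (shr z a) b))
    (trans (regroup′ (low z a) (segment z a b) (shr (shr z a) b) (2 ^ a) (2 ^ b))
      (cong (λ p → low z a + segment z a b * 2 ^ a + shr (shr z a) b * p) (sym (^-distribˡ-+-* 2 a b)))))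
    where
    regroup′ : ∀ l s h A B → l + (s + h * B) * A ≡ (l + s * A) + h * (A * B)
    regroup′ = solve-∀
  small : low z a + segment z a b * 2 ^ a < 2 ^ (a + b)
  small = begin-strict
    low z a + segment z a b * 2 ^ a <⟨ +-monoˡ-< _ (low< z a) ⟩
    suc (segment z a b) * 2 ^ a     ≤⟨ *-monoˡ-≤ (2 ^ a) (low< (shr z a) b) ⟩
    2 ^ b * 2 ^ a                   ≡⟨ trans (*-comm (2 ^ b) _) (sym (^-distribˡ-+-* 2 a b)) ⟩
    2 ^ (a + b)                     ∎
    where open ≤-Reasoning

low-id : ∀ {x j} → x < 2 ^ j → low x j ≡ x
low-id {x} {j} x< = trans (cong (λ x → low x j) (sym (+-identityʳ x))) (low-unique j 0 x<)

-- r is the carry into digit k when the column sums of x y are added up to z.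
CarryInvariant : ℕ → ℕ → ℕ → ℕ → ℕ → ℕ → Set
CarryInvariant w x y z k r =
  encode (convolution (digit w x) (digit w y)) w k ≡ low z (k * w) + r * 2 ^ (k * w)

digitProduct-sound : ∀ {n x y z} → DigitProduct n x y z → x * y ≡ z
digitProduct-sound {n} {x} {y} {z} (w , _ , P , _ , _ , _ , _ , _ , refl , 0<w , div , refl , x< , y< , z< , run)
  with Divides⇒∣ 0<w div
... | divides-refl K = trans (sym (product-digits w K x< y<)) (trans
        (run-invariant 0<w (CarryInvariant w x y z) (sym (trans (+-identityʳ _) (n<1⇒n≡0 (low< z 0)))) (K + K) step
          (subst (λ Q → Run n w (MulStep n w x y z) Q 0) (sym (*-distribʳ-+ w K K)) run))
        (trans (+-identityʳ _) (low-id (subst (λ Q → z < 2 ^ Q) (sym (*-distribʳ-+ w K K)) z<))))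
  where
  step : ∀ k {r r′} → k < K + K → Divides n w (k * w) → CarryInvariant w x y z k r →
         MulStep n w x y z (k * w) r r′ → CarryInvariant w x y z (suc k) r′
  step k {r} {r′} _ _ inv (s , _ , _ , _ , _ , _ , _ , _ , conv , refl , refl , refl , er) = begin
    encode C w (suc k)                             ≡⟨ encode-snoc C w k ⟩
    encode C w k + C k * p                         ≡⟨ cong₂ (λ a b → a + b * p) inv (sym (conv-sound k 0<w conv)) ⟩
    (low z (k * w) + r * p) + s * p                ≡⟨ gather (low z (k * w)) r s p ⟩
    low z (k * w) + (r + s) * p                    ≡⟨ cong (λ e → low z (k * w) + e * p) er ⟩
    low z (k * w) + (segment z (k * w) w + r′ * 2 ^ w) * p
      ≡⟨ regroup′ (low z (k * w)) (segment z (k * w) w) r′ p (2 ^ w) ⟩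
    (low z (k * w) + segment z (k * w) w * p) + r′ * (2 ^ w * p)
      ≡⟨ cong₂ (λ a b → a + r′ * b) (trans (sym (low-+ z (k * w) w)) (cong (low z) (+-comm (k * w) w)))
           (sym (^-distribˡ-+-* 2 w (k * w))) ⟩
    low z (suc k * w) + r′ * 2 ^ (suc k * w)       ∎
    where
    open ≡-Reasoning
    C = convolution (digit w x) (digit w y)
    p = 2 ^ (k * w)
    gather : ∀ l r s p → (l + r * p) + s * p ≡ l + (r + s) * p
    gather = solve-∀
    regroup′ : ∀ l d r p B → l + (d + r * B) * p ≡ (l + d * p) + r * (B * p)
    regroup′ = solve-∀

-- Existence of the guesses for short factors

shr-+* : ∀ a c j → shr (a + c * 2 ^ j) j ≡ shr a j + c
shr-+* a c j = trans (cong (λ x → shr (x + c * 2 ^ j) j) (low+shr a j))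
  (trans (cong (λ x → shr x j) (gather (low a j) (shr a j) c (2 ^ j))) (shr-unique j (shr a j + c) (low< a j)))
  where
  gather : ∀ l s c p → (l + s * p) + c * p ≡ l + (s + c) * p
  gather = solve-∀

low-+* : ∀ a c j → low (a + c * 2 ^ j) j ≡ low a j
low-+* a c j = trans (cong (λ x → low (x + c * 2 ^ j) j) (low+shr a j))
  (trans (cong (λ x → low x j) (gather (low a j) (shr a j) c (2 ^ j))) (low-unique j (shr a j + c) (low< a j)))
  where
  gather : ∀ l s c p → (l + s * p) + c * p ≡ l + (s + c) * p
  gather = solve-∀

shr-< : ∀ {x} a j → x < 2 ^ (a + j) → shr x j < 2 ^ a
shr-< {x} a j x< = *-cancelʳ-< (2 ^ j) _ _ (≤-<-trans
  (≤-trans (m≤n+m _ (low x j)) (≤-reflexive (sym (low+shr x j)))) (subst (x <_) (^-distribˡ-+-* 2 a j) x<))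

module DigitProductComplete {n w K : ℕ} (0<w : 0 < w) (0<K : 0 < K) (few : K + K ≤ 2 ^ (5 * w))
  (cells : 2 ^ (suc (K + K) * (8 * w)) ≤ n) (products : 2 ^ suc (2 ^ (w + (w + w))) ≤ n)
  {x y z : ℕ} (x< : x < 2 ^ (K * w)) (y< : y < 2 ^ (K * w)) (xy≡z : x * y ≡ z) (x≤n : x ≤ n) (y≤n : y ≤ n) (z≤n′ : z ≤ n)
  where

  X Y C r : ℕ → ℕ
  X = digit w x
  Y = digit w y
  C = convolution X Y
  -- The carry into column `k` in closed form: what the first `k` column sums leave above the first
  -- `k` digits.
  r k = shr (encode C w k) (k * w)

  bits≤ : ∀ {j} → j ≤ suc (K + K) * (8 * w) → 2 ^ j ≤ n
  bits≤ j≤ = ≤-trans (^-monoʳ-≤ 2 j≤) cells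

  position≤ : ∀ {k} → k ≤ K + K → k * w ≤ n
  position≤ {k} k≤ = ≤-trans (<⇒≤ (n<2^n _)) (bits≤ (≤-trans (*-mono-≤ k≤ (m≤m+n w _)) (m≤n+m _ (8 * w))))

  nine-cells : w + 8 * w ≤ suc (K + K) * (8 * w)
  nine-cells = subst (_≤ suc (K + K) * (8 * w)) (+-comm (8 * w) w)
    (+-monoʳ-≤ (8 * w) (≤-trans (m≤m+n w _) (≤-trans (≤-reflexive (sym (*-identityˡ (8 * w)))) (*-monoˡ-≤ (8 * w) (≤-trans 0<K (m≤m+n K K))))))

  partial≤ : ∀ k u → partialConv X Y k u ≤ u * (2 ^ w * 2 ^ w)
  partial≤ k zero = z≤n
  partial≤ k (suc u) = subst (partialConv X Y k (suc u) ≤_) (+-comm (u * (2 ^ w * 2 ^ w)) _)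
    (+-mono-≤ (partial≤ k u) (*-mono-≤ (<⇒≤ (low< (shr x (u * w)) w)) (<⇒≤ (low< (shr y ((k ∸ u) * w)) w))))

  -- Up to `2 ^ (5 * w)` terms of at most `2 * w` bits each: the sum is at most `2 ^ (7 * w)` and
  -- fits strictly into a cell of `8 * w` bits.
  partial< : ∀ k {u} → u ≤ K + K → partialConv X Y k u < 2 ^ (8 * w)
  partial< k {u} u≤ = begin-strict
    partialConv X Y k u             ≤⟨ partial≤ k u ⟩
    u * (2 ^ w * 2 ^ w)             ≤⟨ *-monoˡ-≤ _ (≤-trans u≤ few) ⟩
    2 ^ (5 * w) * (2 ^ w * 2 ^ w)   ≡⟨ cong (2 ^ (5 * w) *_) (sym (^-distribˡ-+-* 2 w w)) ⟩
    2 ^ (5 * w) * 2 ^ (w + w)       ≡⟨ sym (^-distribˡ-+-* 2 (5 * w) (w + w)) ⟩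
    2 ^ (5 * w + (w + w))           <⟨ ^-monoʳ-< 2 ≤-refl (subst (5 * w + (w + w) <_) (eight w) (m<m+n _ 0<w)) ⟩
    2 ^ (8 * w)                     ∎
    where
    open ≤-Reasoning
    eight : ∀ w → 5 * w + (w + w) + w ≡ 8 * w
    eight = solve-∀

  conv-complete : ∀ k → k < K + K → Conv n w x y (k * w) (C k)
  conv-complete k k< = suc k * w , position≤ k< , +-comm (k * w) w ,
    run-complete 0<w (partialConv X Y k) refl (suc k) (λ u u≤ → partial< k (≤-trans u≤ k<)) step
      (bits≤ (*-monoˡ-≤ (8 * w) (s≤s k<)))
    where
    step : ∀ u → u < suc k → ConvStep n w x y (k * w) (u * w) (partialConv X Y k u) (partialConv X Y k (suc u))
    step u u≤k = (k ∸ u) * w , position≤ (≤-trans (m∸n≤m k u) (<⇒≤ k<)) ,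
      X u , ≤-trans (segment≤ x (u * w) w) x≤n , Y (k ∸ u) , ≤-trans (segment≤ y ((k ∸ u) * w) w) y≤n ,
      X u * Y (k ∸ u) , ≤-trans (≤-trans (m≤n+m _ (partialConv X Y k u)) (<⇒≤ (partial< k (≤-trans u≤k k<))))
        (bits≤ (≤-trans (m≤n+m _ w) nine-cells)) ,
      trans (sym (*-distribʳ-+ w u (k ∸ u))) (cong (_* w) (m+[n∸m]≡n (≤-pred u≤k))) , refl , refl ,
      smallProduct-complete {h = w} (low< (shr x (u * w)) w) (low< (shr y ((k ∸ u) * w)) w) products , refl

  -- The columns from `k` on contribute multiples of `2 ^ (k * w)`. Thus the first `suc k` columns
  -- already determine digit `k` of `z`, which `digit≡` needs. The induction runs over the number
  -- `d` of remaining columns.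
  tail-sum : ∀ d k → k + d ≡ K + K → ∃ λ M → z ≡ encode C w k + M * 2 ^ (k * w)
  tail-sum zero k e = 0 , trans (sym xy≡z) (trans (sym (product-digits w K x< y<))
    (trans (cong (encode C w) (trans (sym e) (+-identityʳ k))) (sym (+-identityʳ _))))
  tail-sum (suc d) k e with tail-sum d (suc k) (trans (sym (+-suc k d)) e)
  ... | M , z≡ = C k + M * 2 ^ w , trans z≡ (trans (cong₂ (λ a b → a + M * b) (encode-snoc C w k) (^-distribˡ-+-* 2 w (k * w)))
        (gather (encode C w k) (C k) M (2 ^ w) (2 ^ (k * w))))
    where
    gather : ∀ e c M B p → (e + c * p) + M * (B * p) ≡ e + (c + M * B) * p
    gather = solve-∀

  column : ℕ → ℕ
  column k = shr (encode C w (suc k)) (k * w)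

  column≡ : ∀ k → column k ≡ r k + C k
  column≡ k = trans (cong (λ e → shr e (k * w)) (encode-snoc C w k)) (shr-+* (encode C w k) (C k) (k * w))

  r-suc : ∀ k → r (suc k) ≡ shr (column k) w
  r-suc k = trans (cong (shr (encode C w (suc k))) (+-comm w (k * w))) (sym (shr-shr (encode C w (suc k)) (k * w) w))

  digit≡ : ∀ k → k < K + K → segment z (k * w) w ≡ low (column k) w
  digit≡ k k< with tail-sum (K + K ∸ suc k) (suc k) (m+[n∸m]≡n k<)
  ... | M , z≡ = trans (cong (λ z → segment z (k * w) w) (trans z≡ (cong (encode C w (suc k) +_) (regroup′ M))))
        (trans (cong (λ e → low e w) (shr-+* (encode C w (suc k)) (M * 2 ^ w) (k * w))) (low-+* (column k) M w))
    where
    regroup′ : ∀ M → M * 2 ^ (w + k * w) ≡ M * 2 ^ w * 2 ^ (k * w)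
    regroup′ M = trans (cong (M *_) (^-distribˡ-+-* 2 w (k * w))) (sym (*-assoc M _ _))

  r0 : r 0 ≡ 0
  r0 = shr-zero 0

  -- Adding a column sum to the carry at most doubles the bound `2 ^ (8 * w)`, and the division by
  -- `2 ^ w ≥ 2` that yields the next carry restores it; so carries fit into cells as well.
  column<′ : ∀ {k} → k < K + K → r k < 2 ^ (8 * w) → column k < 2 ^ (8 * w + w)
  column<′ {k} k< r< = subst (_< 2 ^ (8 * w + w)) (sym (column≡ k)) (begin-strict
    r k + C k                     <⟨ +-mono-< r< (partial< k k<) ⟩
    2 ^ (8 * w) + 2 ^ (8 * w)     ≡⟨ cong (2 ^ (8 * w) +_) (sym (+-identityʳ _)) ⟩
    2 ^ suc (8 * w)               ≤⟨ ^-monoʳ-≤ 2 (subst (suc (8 * w) ≤_) (+-comm w (8 * w)) (+-monoˡ-≤ (8 * w) 0<w)) ⟩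
    2 ^ (8 * w + w)               ∎)
    where open ≤-Reasoning

  r< : ∀ k → k ≤ K + K → r k < 2 ^ (8 * w)
  r< zero _ = subst (_< 2 ^ (8 * w)) (sym r0) (m^n>0 2 (8 * w))
  r< (suc k) k< = subst (_< 2 ^ (8 * w)) (sym (r-suc k)) (shr-< (8 * w) w (column<′ k< (r< k (<⇒≤ k<))))

  z< : z < 2 ^ ((K + K) * w)
  z< = subst₂ _<_ xy≡z (trans (sym (^-distribˡ-+-* 2 (K * w) (K * w))) (cong (2 ^_) (sym (*-distribʳ-+ w K K)))) (*-mono-< x< y<)

  r-end : r (K + K) ≡ 0
  r-end = from (shr≡0⇔<2^ {encode C w (K + K)} {(K + K) * w}) (subst (_< 2 ^ ((K + K) * w)) (sym (trans (product-digits w K x< y<) xy≡z)) z<)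

  mul-step : ∀ k → k < K + K → MulStep n w x y z (k * w) (r k) (r (suc k))
  mul-step k k< =
    C k , ≤-trans (m≤n+m _ (r k)) column≤ , r (suc k) * 2 ^ w , ≤-trans (m≤n+m _ (segment z (k * w) w)) (≤-trans (≤-reflexive split) column≤) ,
    segment z (k * w) w , ≤-trans (segment≤ z (k * w) w) z≤n′ , r k + C k , column≤ ,
    conv-complete k k< , refl , refl , split , refl
    where
    column≤ : r k + C k ≤ n
    column≤ = subst (_≤ n) (column≡ k) (≤-trans (<⇒≤ (column<′ k< (r< k (<⇒≤ k<))))
      (bits≤ (subst (_≤ suc (K + K) * (8 * w)) (+-comm w (8 * w)) nine-cells)))
    split : segment z (k * w) w + r (suc k) * 2 ^ w ≡ r k + C k
    split = trans (cong₂ (λ a b → a + b * 2 ^ w) (digit≡ k k<) (r-suc k)) (trans (sym (low+shr (column k) w)) (column≡ k))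

  digitProduct-complete : DigitProduct n x y z
  digitProduct-complete = w , ≤-trans (m≤m+n w _) (position≤ {1} (≤-trans 0<K (m≤m+n K K))) , K * w , position≤ (m≤m+n K K) ,
    (K + K) * w , position≤ ≤-refl , 0 , z≤n , refl , 0<w ,
    ∣⇒Divides 0<w (divides K refl) (≤-trans (^-monoʳ-≤ 2 (s≤s (≤-refl {K * w}))) (bits≤ (+-mono-≤ (≤-trans 0<w (m≤m+n w _)) (*-mono-≤ (m≤m+n K K) (m≤m+n w _))))) ,
    sym (*-distribʳ-+ w K K) , x< , y< , z< ,
    subst (Run n w (MulStep n w x y z) ((K + K) * w)) r-end
      (run-complete 0<w r r0 (K + K) r< mul-step cells)

-- From short factors to all factors

-- Products of factors with up to range n ≥ 2^-d log₂ n bits are captured.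
record Multiplication (d : ℕ) : Set₁ where
  field
    Product : ℕ → ℕ → ℕ → ℕ → Set
    productᵈ : ∀ {k} (x y z : Fin k) → Def (λ n ρ → Product n (ρ ! x) (ρ ! y) (ρ ! z))
    sound : ∀ {n x y z} → Product n x y z → x * y ≡ z
    range : ℕ → ℕ
    range-big : ∀ n → n < 2 ^ (2 ^ d * range n)
    complete : ∀ {n x y} → x * y ≤ n → x ≤ n → y ≤ n → x < 2 ^ range n → y < 2 ^ range n → Product n x y (x * y)

module Parameters (L : ℕ) where
  cube : ℕ → ℕ
  cube w = 2 ^ (w + (w + w))

  cube-suc : ∀ w → cube (suc w) ≡ 8 * cube w
  cube-suc w = trans (cong (2 ^_) (three w)) (eight (cube w))
    where
    three : ∀ w → suc w + (suc w + suc w) ≡ suc (suc (suc (w + (w + w))))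
    three = solve-∀
    eight : ∀ c → 2 * (2 * (2 * c)) ≡ 8 * c
    eight = solve-∀

  w<cube : ∀ w → w < cube w
  w<cube w = <-≤-trans (n<2^n w) (^-monoʳ-≤ 2 (m≤m+n w (w + w)))

  -- The factor 24 is 3 times 8: at most `3 K` cells of `8 w` bits are needed, where
  -- `K * w ≤ cube w`. Taking the largest admissible `w` keeps `K * w` within a constant factor of
  -- `L`.
  digit-width : 24 * cube 1 ≤ L → ∃ λ w → 0 < w × 24 * cube w ≤ L × L < 24 * cube (suc w)
  digit-width big = search L 1 (s≤s z≤n) big (≤-reflexive (+-comm 1 L))
    where
    search : ∀ fuel w → 0 < w → 24 * cube w ≤ L → L < fuel + w → ∃ λ w → 0 < w × 24 * cube w ≤ L × L < 24 * cube (suc w)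
    search zero w 0<w ok L<w = contradiction (≤-trans (m≤m+n (cube w) _) ok) (<⇒≱ (<-trans L<w (w<cube w)))
    search (suc fuel) w 0<w ok L< with 24 * cube (suc w) ≤? L
    ... | no ¬p = w , 0<w , ok , ≰⇒> ¬p
    ... | yes p = search fuel (suc w) (s≤s z≤n) p (subst (L <_) (sym (+-suc fuel w)) L<)

  record Fits : Set where
    field
      w K : ℕ
      0<w : 0 < w
      0<K : 0 < K
      few : K + K ≤ 2 ^ (5 * w)
      cells : suc (K + K) * (8 * w) ≤ L
      products : suc (cube w) ≤ L
      -- K w is at least L/384, so nine doublings will reach L bits.
      large : suc L ≤ 2 ^ 9 * (K * w)

  fits : 24 * cube 1 ≤ L → Fits
  fits big with digit-width big
  ... | w@(suc _) , 0<w , ok , L< = record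
    { w = w ; K = K ; 0<w = 0<w ; 0<K = 0<K
    ; few = ≤-trans (+-mono-≤ K≤ K≤) (≤-trans (≤-reflexive (cong (cube w +_) (sym (+-identityʳ _))))
        (^-monoʳ-≤ 2 (≤-trans (+-monoˡ-≤ (w + (w + w)) {1} {w + w} (≤-trans 0<w (m≤m+n w w))) (≤-reflexive (five w)))))
    ; cells = begin
        suc (K + K) * (8 * w)     ≤⟨ *-monoˡ-≤ (8 * w) (+-monoˡ-≤ (K + K) 0<K) ⟩
        (K + (K + K)) * (8 * w)   ≡⟨ regroup′ K w ⟩
        24 * (K * w)              ≤⟨ *-monoʳ-≤ 24 Kw≤ ⟩
        24 * cube w               ≤⟨ ok ⟩
        L                         ∎
    ; products = ≤-trans (+-mono-≤ (≤-trans (s≤s z≤n) (w<cube w)) (m≤m+n (cube w) (22 * cube w))) ok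
    ; large = begin
        suc L                     ≤⟨ L< ⟩
        24 * cube (suc w)         ≡⟨ cong (24 *_) (cube-suc w) ⟩
        -- The factor 8 is lost by the maximality of `w`, the factor 2 by rounding in
        -- `K = cube w / w`; 24 is raised to 32 to make the total a power of two.
        24 * (8 * cube w)         ≤⟨ *-mono-≤ (m≤m+n 24 8) (*-monoʳ-≤ 8 cube≤) ⟩
        32 * (8 * (2 * (K * w)))  ≡⟨ cong (32 *_) (sym (*-assoc 8 2 (K * w))) ⟩
        32 * (16 * (K * w))       ≡⟨ sym (*-assoc 32 16 (K * w)) ⟩
        2 ^ 9 * (K * w)           ∎ }
    where
    open ≤-Reasoning
    K : ℕ
    K = cube w / w
    Kw≤ : K * w ≤ cube w
    Kw≤ = m/n*n≤m (cube w) w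
    0<K : 0 < K
    0<K = m≥n⇒m/n>0 (<⇒≤ (w<cube w))
    K≤ : K ≤ cube w
    K≤ = m/n≤m (cube w) w
    cube≤ : cube w ≤ 2 * (K * w)
    cube≤ = subst (λ e → cube w ≤ K * w + e) (sym (+-identityʳ (K * w))) (≤-trans (≤-reflexive (m≡m%n+[m/n]*n (cube w) w)) (+-monoˡ-≤ (K * w)
      (≤-trans (<⇒≤ (m%n<n (cube w) w)) (≤-trans (≤-reflexive (sym (*-identityˡ w))) (*-monoˡ-≤ w 0<K)))))
    five : ∀ w → w + w + (w + (w + w)) ≡ 5 * w
    five = solve-∀
    regroup′ : ∀ K w → (K + (K + K)) * (8 * w) ≡ 24 * (K * w)
    regroup′ = solve-∀

-- When `n` is too small to guarantee room for digits, the range is a single bit; the factors 0 and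
-- 1 are therefore treated directly.
BaseProduct : ℕ → ℕ → ℕ → ℕ → Set
BaseProduct n x y z = (x ≡ 0 × z ≡ 0) ⊎ (x ≡ 1 × y ≡ z) ⊎ DigitProduct n x y z

baseProduct-below2 : ∀ {n x y} → x < 2 ^ 1 → BaseProduct n x y (x * y)
baseProduct-below2 {x = zero} _ = inj₁ (refl , refl)
baseProduct-below2 {x = suc zero} _ = inj₂ (inj₁ (refl , sym (+-identityʳ _)))
baseProduct-below2 {x = suc (suc x)} (s≤s (s≤s ()))

module BaseRange (n : ℕ) where
  InRange : ℕ → Set
  InRange b = n < 2 ^ (2 ^ 9 * b) ×
    (∀ {x y} → x * y ≤ n → x ≤ n → y ≤ n → x < 2 ^ b → y < 2 ^ b → BaseProduct n x y (x * y))

  tiny : ∀ {b} → b ≡ 1 → n < 2 ^ (2 ^ 9 * b) → InRange b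
  tiny refl n< = n< , λ _ _ _ x< _ → baseProduct-below2 x<

  small : ∀ {L b} → b ≡ 1 → n < 2 ^ suc L → ¬ (24 * Parameters.cube L 1 ≤ L) → InRange b
  -- `24 * cube 1` is 192, so `n` has at most 192 bits, and nine doublings of one bit give 512.
  small {L} {b} e hi few = tiny e (<-≤-trans hi (^-monoʳ-≤ 2 (≤-trans (≰⇒> few) (≤-trans (m≤m+n 192 320)
    (≤-trans (≤-reflexive (sym (*-identityʳ 512))) (*-monoʳ-≤ 512 (≤-reflexive (sym e))))))))

  big : ∀ {L} → 2 ^ L ≤ n → n < 2 ^ suc L → Parameters.Fits L → ∃ InRange
  big lo hi fits = K * w , <-≤-trans hi (^-monoʳ-≤ 2 large) , λ xy≤ x≤ y≤ x< y< → inj₂ (inj₂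
    (DigitProductComplete.digitProduct-complete {n = n} {w = w} {K = K} 0<w 0<K few
      (≤-trans (^-monoʳ-≤ 2 cells) lo) (≤-trans (^-monoʳ-≤ 2 products) lo) x< y< refl x≤ y≤ xy≤))
    where open Parameters.Fits fits

  zero-range : n ≡ 0 → ∀ b → b ≡ 1 → InRange b
  zero-range n≡0 b e = tiny e (subst (_< 2 ^ (2 ^ 9 * b)) (sym n≡0) (m^n>0 2 (2 ^ 9 * b)))

  inRange : ∃ InRange
  inRange with n ≟ 0
  ... | yes e = 1 , zero-range e 1 refl
  ... | no n≢0 with topBit n (n≢0⇒n>0 n≢0)
  ...   | L , lo , hi with 24 * Parameters.cube L 1 ≤? L
  ...     | no few = 1 , small refl hi few
  ...     | yes enough = big lo hi (Parameters.fits L enough)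

baseMultiplication : Multiplication 9
baseMultiplication = record
  { Product = BaseProduct
  ; productᵈ = λ x y z → zeroᵈ x ∧ᵈ zeroᵈ z ∨ᵈ constᵈ 1 x ∧ᵈ eqᵈ y z ∨ᵈ digitProductᵈ x y z
  ; sound = λ { (inj₁ (refl , refl)) → refl ; (inj₂ (inj₁ (refl , refl))) → +-identityʳ _ ; (inj₂ (inj₂ p)) → digitProduct-sound p }
  ; range = λ n → proj₁ (BaseRange.inRange n)
  ; range-big = λ n → proj₁ (proj₂ (BaseRange.inRange n))
  ; complete = λ {n} → proj₂ (proj₂ (BaseRange.inRange n))
  }

module Double (d : ℕ) (M : Multiplication (suc d)) where
  open Multiplication M

  -- Horner's form keeps every intermediate value below the final product, hence inside [n].
  Assembled : ℕ → ℕ → ℕ → ℕ → ℕ → ℕ → ℕ → Set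
  Assembled n h a b c e z = ∃[ s ≤ n ] ∃[ t ≤ n ] ∃[ u ≤ n ] ∃[ v ≤ n ]
    (b + c ≡ s × t ≡ a * 2 ^ h × t + s ≡ u × v ≡ u * 2 ^ h × v + e ≡ z)

  Product′ : ℕ → ℕ → ℕ → ℕ → Set
  Product′ n x y z = ∃[ h ≤ n ] ∃[ x₁ ≤ n ] ∃[ x₀ ≤ n ] ∃[ y₁ ≤ n ] ∃[ y₀ ≤ n ]
    ((x₁ ≡ shr x h × x₀ ≡ low x h × y₁ ≡ shr y h × y₀ ≡ low y h) ×
     (∃[ a ≤ n ] ∃[ b ≤ n ] ∃[ c ≤ n ] ∃[ e ≤ n ]
       ((Product n x₁ y₁ a × Product n x₁ y₀ b × Product n x₀ y₁ c × Product n x₀ y₀ e) ×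
        Assembled n h a b c e z)))

  product′ᵈ : (x y z : Fin k) → Def (λ n ρ → Product′ n (ρ ! x) (ρ ! y) (ρ ! z))
  product′ᵈ x y z = ∃ᵈ ∃ᵈ ∃ᵈ ∃ᵈ ∃ᵈ
    (shrᵈ (s5 x) v4 v3 ∧ᵈ lowᵈ (s5 x) v4 v2 ∧ᵈ shrᵈ (s5 y) v4 v1 ∧ᵈ lowᵈ (s5 y) v4 v0) ∧ᵈ
    (∃ᵈ ∃ᵈ ∃ᵈ ∃ᵈ (productᵈ (s4 v3) (s4 v1) v3 ∧ᵈ productᵈ (s4 v3) (s4 v0) v2 ∧ᵈ
      productᵈ (s4 v2) (s4 v1) v1 ∧ᵈ productᵈ (s4 v2) (s4 v0) v0) ∧ᵈ
     (∃ᵈ ∃ᵈ ∃ᵈ ∃ᵈ +ᵈ (s4 v2) (s4 v1) v3 ∧ᵈ shlᵈ (s4 v3) (s4 (s4 v4)) v2 ∧ᵈ +ᵈ v2 v3 v1 ∧ᵈ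
       shlᵈ v1 (s4 (s4 v4)) v0 ∧ᵈ +ᵈ v0 (s4 v0) (s4 (s4 (s5 z)))))

  expand : ∀ x₁ x₀ y₁ y₀ H → (x₁ * y₁ * H + (x₁ * y₀ + x₀ * y₁)) * H + x₀ * y₀ ≡ (x₀ + x₁ * H) * (y₀ + y₁ * H)
  expand = solve-∀

  sound′ : ∀ {n x y z} → Product′ n x y z → x * y ≡ z
  sound′ {n} {x} {y} (h , _ , x₁ , _ , x₀ , _ , y₁ , _ , y₀ , _ , (refl , refl , refl , refl) ,
      (_ , _ , _ , _ , _ , _ , _ , _ , (pa , pb , pc , pe) , (_ , _ , _ , _ , _ , _ , _ , _ , refl , refl , refl , refl , e)))
    with sound pa | sound pb | sound pc | sound pe
  ... | refl | refl | refl | refl = trans (cong₂ _*_ (low+shr x h) (low+shr y h))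
        (trans (sym (expand x₁ x₀ y₁ y₀ (2 ^ h))) e)

  -- The natural cut is at `b`, but the cut must be an element. If `b` exceeds `n`, the cut is at
  -- `n`: every `x ≤ n` is less than `2 ^ n`, so the upper part is 0 and the lower one is still less
  -- than `2 ^ b`.
  split : ∀ {n} b → ∃ λ h → h ≤ n × (∀ {x} → x ≤ n → x < 2 ^ (b + b) → shr x h < 2 ^ b × low x h < 2 ^ b)
  split {n} b with b ≤? n
  ... | yes b≤n = b , b≤n , λ {x} _ x< → shr-< b b x< , low< x b
  ... | no b≰n = n , ≤-refl , λ {x} x≤n _ → subst (_< 2 ^ b) (sym (from (shr≡0⇔<2^ {x} {n}) (≤⇒<2^ x≤n))) (m^n>0 2 b) ,
        ≤-<-trans (low≤ x n) (<-≤-trans (≤⇒<2^ x≤n) (^-monoʳ-≤ 2 (≰⇒≥ b≰n)))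

  complete′ : ∀ {n x y} → x * y ≤ n → x ≤ n → y ≤ n → x < 2 ^ (range n + range n) → y < 2 ^ (range n + range n) →
              Product′ n x y (x * y)
  complete′ {n} {x} {y} xy≤n x≤n y≤n x< y< with split {n} (range n)
  ... | h , h≤n , parts = h , h≤n , x₁ , x₁≤ , x₀ , x₀≤ , y₁ , y₁≤ , y₀ , y₀≤ , (refl , refl , refl , refl) ,
      (a , a≤ , b , b≤ , c , c≤ , e , e≤ ,
        (complete a≤ x₁≤ y₁≤ x₁< y₁< , complete b≤ x₁≤ y₀≤ x₁< y₀< , complete c≤ x₀≤ y₁≤ x₀< y₁< , complete e≤ x₀≤ y₀≤ x₀< y₀<) ,
        (b + c , s≤ , a * H , ≤-trans (m≤m+n (a * H) (b + c)) u≤ , a * H + (b + c) , u≤ , v , v≤ , refl , refl , refl , refl , total))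
    where
    H x₁ x₀ y₁ y₀ a b c e v : ℕ
    H = 2 ^ h
    x₁ = shr x h
    x₀ = low x h
    y₁ = shr y h
    y₀ = low y h
    a = x₁ * y₁
    b = x₁ * y₀
    c = x₀ * y₁
    e = x₀ * y₀
    v = (a * H + (b + c)) * H
    x₁≤ = ≤-trans (shr≤ x h) x≤n
    x₀≤ = ≤-trans (low≤ x h) x≤n
    y₁≤ = ≤-trans (shr≤ y h) y≤n
    y₀≤ = ≤-trans (low≤ y h) y≤n
    x₁< = proj₁ (parts x≤n x<)
    x₀< = proj₂ (parts x≤n x<)
    y₁< = proj₁ (parts y≤n y<)
    y₀< = proj₂ (parts y≤n y<)
    total : v + e ≡ x * y
    total = trans (expand x₁ x₀ y₁ y₀ H) (sym (cong₂ _*_ (low+shr x h) (low+shr y h)))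
    total≤ : v + e ≤ n
    total≤ = subst (_≤ n) (sym total) xy≤n
    v≤ = ≤-trans (m≤m+n v e) total≤
    e≤ = ≤-trans (m≤n+m e v) total≤
    ×H≤ : ∀ {i m} → i * H ≤ m → i ≤ m
    ×H≤ {i} p = ≤-trans (≤-trans (≤-reflexive (sym (*-identityʳ i))) (*-monoʳ-≤ i (m^n>0 2 h))) p
    u≤ = ×H≤ v≤
    s≤ = ≤-trans (m≤n+m (b + c) (a * H)) u≤
    a≤ = ×H≤ (≤-trans (m≤m+n (a * H) (b + c)) u≤)
    b≤ = ≤-trans (m≤m+n b c) s≤
    c≤ = ≤-trans (m≤n+m c b) s≤

  doubled : Multiplication d
  doubled = record
    { Product = Product′
    ; productᵈ = product′ᵈ
    ; sound = sound′
    ; range = λ n → range n + range n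
    ; range-big = λ n → subst (λ b → n < 2 ^ b) (regroup′ (2 ^ d) (range n)) (range-big n)
    ; complete = complete′
    }
    where
    regroup′ : ∀ p r → 2 * p * r ≡ p * (r + r)
    regroup′ = solve-∀

multiplication : ∀ d → Multiplication d → Multiplication 0
multiplication zero M = M
multiplication (suc d) M = multiplication d (Double.doubled d M)

opaque
  fullMultiplication : Multiplication 0
  fullMultiplication = multiplication 9 baseMultiplication

*ᵈ : (x y z : Fin k) → Def (λ n ρ → ρ ! x * ρ ! y ≡ ρ ! z)
*ᵈ x y z = reformulate (productᵈ x y z) λ {n} B →
  let wide : ∀ {a} → a ≤ n → a < 2 ^ range n
      wide a≤n = ≤-<-trans a≤n (subst (λ b → n < 2 ^ b) (+-identityʳ (range n)) (range-big n))
  in mk⇔ sound (λ e → subst (Product n _ _) e (complete (≤-trans (≤-reflexive e) (B z)) (B x) (B y) (wide (B x)) (wide (B y))))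
  where open Multiplication fullMultiplication

-- Triangular numbers, columns and rows, and the predicates C and Q

tri-even : ∀ h → h * suc (h + h) ≡ tri (h + h)
tri-even h = sym (trans (cong (_/ 2) (expand h)) (m*n/n≡m (h * suc (h + h)) 2))
  where
  expand : ∀ h → (h + h) * suc (h + h) ≡ h * suc (h + h) * 2
  expand = solve-∀

tri-odd : ∀ h → suc (h + h) * suc h ≡ tri (suc (h + h))
tri-odd h = sym (trans (cong (_/ 2) (expand h)) (m*n/n≡m (suc (h + h) * suc h) 2))
  where
  expand : ∀ h → suc (h + h) * suc (suc (h + h)) ≡ suc (h + h) * suc h * 2
  expand = solve-∀

even-or-odd : ∀ c → ∃ λ h → h + h ≡ c ⊎ suc (h + h) ≡ c
even-or-odd zero = 0 , inj₁ refl
even-or-odd (suc c) with even-or-odd c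
... | h , inj₁ e = h , inj₂ (cong suc e)
... | h , inj₂ e = suc h , inj₁ (cong suc (trans (+-suc h h) e))

-- The even one of `c` and `suc c` is halved before multiplying, because their product may exceed
-- `n` although `tri c` does not. The case `c ≡ 0` is separate since `suc c` is no element when `n`
-- is 0.
Triangular : ℕ → ℕ → ℕ → Set
Triangular n c t = (c ≡ 0 × t ≡ 0) ⊎
  (∃[ h ≤ n ] ∃[ d ≤ n ] (h + h ≡ c × suc c ≡ d × h * d ≡ t)) ⊎
  (∃[ h ≤ n ] ∃[ d ≤ n ] ∃[ e ≤ n ] (h + h ≡ d × suc d ≡ c × suc h ≡ e × c * e ≡ t))

triᵈ : (c t : Fin k) → Def (λ n ρ → tri (ρ ! c) ≡ ρ ! t)
triᵈ c t = reformulate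
  (zeroᵈ c ∧ᵈ zeroᵈ t ∨ᵈ
   (∃ᵈ ∃ᵈ +ᵈ v1 v1 (s2 c) ∧ᵈ sucᵈ (s2 c) v0 ∧ᵈ *ᵈ v1 v0 (s2 t)) ∨ᵈ
   (∃ᵈ ∃ᵈ ∃ᵈ +ᵈ v2 v2 v1 ∧ᵈ sucᵈ v1 (s3 c) ∧ᵈ sucᵈ v2 v0 ∧ᵈ *ᵈ (s3 c) v0 (s3 t)))
  λ {n} {ρ} B → mk⇔ sound-tri (λ e → complete-tri (B c) (subst (_≤ n) (sym e) (B t)) e)
  where
  sound-tri : ∀ {n c t} → Triangular n c t → tri c ≡ t
  sound-tri (inj₁ (refl , refl)) = refl
  sound-tri (inj₂ (inj₁ (h , _ , _ , _ , refl , refl , e))) = trans (sym (tri-even h)) e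
  sound-tri (inj₂ (inj₂ (h , _ , _ , _ , _ , _ , refl , refl , refl , e))) = trans (sym (tri-odd h)) e
  complete-tri : ∀ {n c t} → c ≤ n → tri c ≤ n → tri c ≡ t → Triangular n c t
  complete-tri {n} {c} c≤n t≤n e with even-or-odd c
  ... | zero , inj₁ refl = inj₁ (refl , sym e)
  ... | h@(suc _) , inj₁ refl = inj₂ (inj₁ (h , ≤-trans (m≤m+n h h) c≤n , suc (h + h) ,
        ≤-trans (m≤m+n (suc (h + h)) _) (subst (_≤ n) (sym (tri-even h)) t≤n) , refl , refl , trans (tri-even h) e))
  ... | h , inj₂ refl = inj₂ (inj₂ (h , ≤-trans (m≤m+n h h) (≤-trans (n≤1+n _) c≤n) , h + h , ≤-trans (n≤1+n _) c≤n ,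
        suc h , ≤-trans (s≤s (m≤m+n h h)) c≤n , refl , refl , refl , trans (tri-odd h) e))

positionᵈ : (x c r : Fin k) → Def (λ n ρ → col (ρ ! x) ≡ ρ ! c × row (ρ ! x) ≡ ρ ! r)
positionᵈ x c r = reformulate (∃ᵈ triᵈ (s1 c) v0 ∧ᵈ +ᵈ v0 (s1 r) (s1 x) ∧ᵈ ≤ᵈ (s1 r) (s1 c))
  λ {n} {ρ} B → mk⇔ (λ { (_ , _ , refl , e , r≤c) → position-unique (e , r≤c) })
    (λ (ec , er) → let (e , r≤c) = subst₂ (Position (ρ ! x)) ec er (position (ρ ! x)) in
       tri (ρ ! c) , ≤-trans (m≤m+n _ (ρ ! r)) (subst (_≤ n) (sym e) (B x)) , refl , e , r≤c)

row≤ : ∀ x → row x ≤ x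
row≤ x = ≤-trans (row≤col x) (col≤ x)

⊏ᵈ : (x y : Fin k) → Def (λ n ρ → (ρ ! x) ⊏ (ρ ! y))
⊏ᵈ x y = reformulate
  (∃ᵈ ∃ᵈ ∃ᵈ ∃ᵈ positionᵈ (s4 x) v3 v2 ∧ᵈ positionᵈ (s4 y) v1 v0 ∧ᵈ (<ᵈ v2 v0 ∨ᵈ eqᵈ v2 v0 ∧ᵈ <ᵈ v3 v1))
  λ {n} {ρ} B → mk⇔ (λ { (_ , _ , _ , _ , _ , _ , _ , _ , (refl , refl) , (refl , refl) , below) → below })
    (λ below → _ , ≤-trans (col≤ (ρ ! x)) (B x) , _ , ≤-trans (row≤ (ρ ! x)) (B x) ,
            _ , ≤-trans (col≤ (ρ ! y)) (B y) , _ , ≤-trans (row≤ (ρ ! y)) (B y) , (refl , refl) , (refl , refl) , below)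

-- Makes `suc (col x)` an element. For `x` equal to 0 or 1 it exceeds `x`, so the formulas for `C`
-- and `Q` decide these two values outright.
col< : ∀ {x} → 2 ≤ x → col x < x
col< {x} 2≤x with col x in e
... | zero = ≤-trans (s≤s z≤n) 2≤x
... | suc zero = 2≤x
... | suc (suc c) = ≤-trans (subst (suc (suc (suc c)) ≤_) (sym (tri-suc (suc c)))
        (+-monoˡ-≤ (suc (suc c)) (≤-trans (s≤s z≤n) (n≤tri (suc c))))) (subst (λ c → tri c ≤ x) e (bot≤ x))

CPredᵈ : (x : Fin k) → Def (λ n ρ → CPred (ρ ! x))
CPredᵈ x = reformulate
  (zeroᵈ x ∨ᵈ (∃ᵈ ∃ᵈ ∃ᵈ positionᵈ (s3 x) v2 v1 ∧ᵈ sucᵈ v2 v0 ∧ᵈ atᵈ v0 v1))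
  λ {n} {ρ} B → ⇔-trans (mk⇔ ltr (rtl (B x))) (⇔-sym (Bit⇔at (suc (col (ρ ! x))) (row (ρ ! x))))
  where
  opaque
    unfolding _at_
    zero-true : 1 at 0 ≡ true
    zero-true = refl
    one-false : 2 at 0 ≡ false
    one-false = refl
  Formula′ : ℕ → ℕ → Set
  Formula′ n x = x ≡ 0 ⊎ (∃[ c ≤ n ] ∃[ r ≤ n ] ∃[ d ≤ n ] ((col x ≡ c × row x ≡ r) × suc c ≡ d × d at r ≡ true))
  ltr : ∀ {n x} → Formula′ n x → suc (col x) at row x ≡ true
  ltr (inj₁ refl) = zero-true
  ltr (inj₂ (_ , _ , _ , _ , _ , _ , (refl , refl) , refl , e)) = e
  rtl : ∀ {n x} → x ≤ n → suc (col x) at row x ≡ true → Formula′ n x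
  rtl {x = zero} _ _ = inj₁ refl
  rtl {x = suc zero} _ e = contradiction one-false (true≢false e)
  rtl {x = x@(suc (suc _))} x≤n e = inj₂ (_ , ≤-trans (col≤ x) x≤n , _ , ≤-trans (row≤ x) x≤n ,
    _ , ≤-trans (col< {x} (s≤s (s≤s z≤n))) x≤n , (refl , refl) , refl , e)

-- `tri (suc (col x))` is greater than `x` and may lie outside [n]. Its summands `tri (col x)` and
-- `suc (col x)` are elements once `2 ≤ x`, and the required bit of their sum is read off by carry
-- look-ahead without forming the sum.
QPredᵈ : (x : Fin k) → Def (λ n ρ → QPred (ρ ! x))
QPredᵈ x = reformulate
  (zeroᵈ x ∨ᵈ constᵈ 1 x ∨ᵈ (∃ᵈ ∃ᵈ ∃ᵈ ∃ᵈ positionᵈ (s4 x) v3 v2 ∧ᵈ sucᵈ v3 v1 ∧ᵈ triᵈ v3 v0 ∧ᵈ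
    xorᵇ (xorᵇ (atᵈ v0 v2) (atᵈ v1 v2)) (carryᵈ v0 v1 v2)))
  λ {n} {ρ} B → ⇔-trans (mk⇔ ltr (rtl (B x))) (⇔-sym (Bit⇔at (tri (suc (col (ρ ! x)))) (row (ρ ! x))))
  where
  opaque
    unfolding _at_
    zero-true : 1 at 0 ≡ true
    zero-true = refl
    one-true : 3 at 0 ≡ true
    one-true = refl
  Formula′ : ℕ → ℕ → Set
  Formula′ n x = x ≡ 0 ⊎ x ≡ 1 ⊎ (∃[ c ≤ n ] ∃[ r ≤ n ] ∃[ d ≤ n ] ∃[ t ≤ n ]
    ((col x ≡ c × row x ≡ r) × suc c ≡ d × tri c ≡ t × (t at r xor d at r) xor carry t d r ≡ true))
  sum-bit : ∀ x → tri (suc (col x)) at row x ≡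
            (tri (col x) at row x xor suc (col x) at row x) xor carry (tri (col x)) (suc (col x)) (row x)
  sum-bit x = trans (cong (_at row x) (tri-suc (col x))) (at-+ (tri (col x)) (suc (col x)) (row x))
  ltr : ∀ {n x} → Formula′ n x → tri (suc (col x)) at row x ≡ true
  ltr (inj₁ refl) = zero-true
  ltr (inj₂ (inj₁ refl)) = one-true
  ltr {x = x} (inj₂ (inj₂ (_ , _ , _ , _ , _ , _ , _ , _ , (refl , refl) , refl , refl , e))) = trans (sum-bit x) e
  rtl : ∀ {n x} → x ≤ n → tri (suc (col x)) at row x ≡ true → Formula′ n x
  rtl {x = zero} _ _ = inj₁ refl
  rtl {x = suc zero} _ e = inj₂ (inj₁ refl)
  rtl {x = x@(suc (suc _))} x≤n e = inj₂ (inj₂ (_ , ≤-trans (col≤ x) x≤n , _ , ≤-trans (row≤ x) x≤n ,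
    _ , ≤-trans (col< {x} (s≤s (s≤s z≤n))) x≤n , _ , ≤-trans (bot≤ x) x≤n , (refl , refl) , refl , refl ,
    trans (sym (sum-bit x)) e))

define-LSCQ : ∀ {k j} (P : SymLSCQ j) (xs : Vec (Fin k) j) → Def (λ n ρ → ⟦ P ⟧LSCQ (V.map (ρ !_) xs))
define-LSCQ lt (x ∷ y ∷ []) = <ᵈ x y
define-LSCQ sq (x ∷ y ∷ []) = ⊏ᵈ x y
define-LSCQ cC (x ∷ []) = CPredᵈ x
define-LSCQ qQ (x ∷ []) = QPredᵈ x

LSCQ≼LBit : LSCQ ≼ LBit
LSCQ≼LBit = Translation.≼-translate LSCQ LBit decLBit define-LSCQ

theorem3p1 : SameExpressivePower LSCQ LBit
theorem3p1 = LSCQ≼LBit , RowDefinability.LBit≼LSCQ
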